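{- Let $n=2pq$, where $p<q$ are odd primes. For $i\in\{0,1,\dots,n-1\}$ let $R_i(x)$ denote the remainder of $x^i\Phi_n^T(x)$ modulo $x^n-1$, i.e. the polynomial obtained from $x^i\Phi_n^T(x)$ by reducing all exponents modulo $n$ to $\{0,\dots,n-1\}$. Then: (1) $\deg(R_i(x))>\deg(\Phi_n^T(x))$ for all $i\in\{0,1,\dots,n-1\}$ with $i\neq 0$ and $i\neq \frac{n}{2}-p$. (2) $\deg(\Phi_n^T(x))=\deg(R_{\frac{n}{2}-p}(x))=\frac{n}{2}+\varphi(n)-p=n-2p-q+1$.
   Context: $\varphi$ is Euler's totient function and $\Phi_n(x)$ is the $n$-th cyclotomic polynomial. For $n=2pq$ with $p<q$ odd primes, all coefficients of $\Phi_n(x)$ lie in $\{ -1,0,1\}$ (a known fact). Write uniquely $\Phi_n(x)=f_1(x)-f_2(x)$, where $f_1,f_2$ are polynomials all of whose nonzero coefficients equal $1$ and no power of $x$ occurs in both $f_1$ and $f_2$. Define $\Phi_n^T(x)=f_1(x)+x^{n/2}f_2(x)$, a polynomial with coefficients in $\{0,1\}$ and degree at most $n-1$. -}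

module Defs where

open import Data.Bool.Base using (if_then_else_)
open import Data.Integer.Base as ℤ using (ℤ; 0ℤ; 1ℤ; -1ℤ)
open import Data.Integer.Properties as ℤ using ()
open import Data.List.Base using (List; []; _∷_; map; foldr; filter; length; replicate; upTo; _++_)
open import Data.List.Relation.Unary.All using (all?)
open import Data.Nat.Base as ℕ using (ℕ; zero; suc)
open import Data.Nat.Coprimality using (coprime?)
open import Data.Nat.Divisibility using (_∣?_)
import Data.Nat.DivMod as ℕ
open import Data.Product.Base using (_×_; _,_; proj₁; proj₂)
open import Data.Sum.Base using (_⊎_; inj₁; inj₂)
open import Relation.Binary.PropositionalEquality
  using (_≡_; _≢_; refl; sym; trans; cong; cong₂)
open import Relation.Nullary using (yes; no; contradiction)
open import Relation.Nullary.Decidable using (does)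

-- ℤ[x] as coefficient lists, constant term first.  Trailing zeros are allowed,
-- so lists denote the same polynomial when they agree up to _≈_.

Poly : Set
Poly = List ℤ

coeff : Poly → ℕ → ℤ
coeff []      _       = 0ℤ
coeff (a ∷ f) zero    = a
coeff (a ∷ f) (suc k) = coeff f k

infix 4 _≈_

_≈_ : Poly → Poly → Set
f ≈ g = ∀ k → coeff f k ≡ coeff g k

-- Trailing zeros are disregarded.  The zero polynomial is given degree 0.

deg : Poly → ℕ
deg []      = 0
deg (a ∷ f) with all? (ℤ._≟ 0ℤ) f
... | yes _ = 0
... | no  _ = suc (deg f)

infixl 6 _+ₚ_ _-ₚ_
infixl 7 _·ₚ_ _*ₚ_ _÷ₚ_ _%ₚ_
infix  8 x^_

_+ₚ_ : Poly → Poly → Poly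
[]      +ₚ g       = g
(a ∷ f) +ₚ []      = a ∷ f
(a ∷ f) +ₚ (b ∷ g) = (a ℤ.+ b) ∷ (f +ₚ g)

_·ₚ_ : ℤ → Poly → Poly
c ·ₚ f = map (c ℤ.*_) f

_-ₚ_ : Poly → Poly → Poly
f -ₚ g = f +ₚ -1ℤ ·ₚ g

_*ₚ_ : Poly → Poly → Poly
[]      *ₚ g = []
(a ∷ f) *ₚ g = a ·ₚ g +ₚ (0ℤ ∷ f *ₚ g)

1ₚ : Poly
1ₚ = 1ℤ ∷ []

x^_ : ℕ → Poly
x^ k = replicate k 0ℤ ++ 1ₚ

∏ : List Poly → Poly
∏ = foldr _*ₚ_ 1ₚ

-- Quotient and remainder on division by g, which must be monic.  From
-- f = q g + r one gets a + x f = (c + x q) g + (a + x r - c g), where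
-- c is the coefficient of a + x r at deg g.

divStep : Poly → ℤ → Poly × Poly → Poly × Poly
divStep g a (q , r) = c ∷ q , (a ∷ r) -ₚ c ·ₚ g
  where
  c : ℤ
  c = coeff (a ∷ r) (deg g)

divMod : Poly → Poly → Poly × Poly
divMod f g = foldr (divStep g) ([] , []) f

_÷ₚ_ : Poly → Poly → Poly
f ÷ₚ g = proj₁ (divMod f g)

_%ₚ_ : Poly → Poly → Poly
f %ₚ g = proj₂ (divMod f g)

-- Φ n is determined by  ∏_{d ∣ n} Φ d = x^n - 1  for n ≥ 1, that is,
-- Φ n = (x^n - 1) ÷ ∏_{d ∣ n, d < n} Φ d.  Φ 0 = 1 is a convention.
-- table n lists the pairs (d , Φ d) for d = n, …, 1.

mutual
  Φ : ℕ → Poly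
  Φ zero    = 1ₚ
  Φ (suc m) = (x^ (suc m) -ₚ 1ₚ)
            ÷ₚ ∏ (map proj₂ (filter (λ dΦ → proj₁ dΦ ∣? suc m) (table m)))

  table : ℕ → List (ℕ × Poly)
  table zero    = []
  table (suc m) = (suc m , Φ (suc m)) ∷ table m

φ : ℕ → ℕ
φ n = length (filter (coprime? n) (map suc (upTo n)))

-- The sum of the monomials x^k at which f has coefficient u.

indicator : ℤ → ℤ → ℤ
indicator u c = if does (c ℤ.≟ u) then 1ℤ else 0ℤ

support : ℤ → Poly → Poly
support u f = map (indicator u) f

record IsSplitting (f f₁ f₂ : Poly) : Set where
  field
    difference : f ≈ f₁ -ₚ f₂
    ones₁      : ∀ k → coeff f₁ k ≢ 0ℤ → coeff f₁ k ≡ 1ℤ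
    ones₂      : ∀ k → coeff f₂ k ≢ 0ℤ → coeff f₂ k ≡ 1ℤ
    disjoint   : ∀ k → coeff f₁ k ≡ 0ℤ ⊎ coeff f₂ k ≡ 0ℤ

Flat : Poly → Set
Flat f = ∀ k → coeff f k ≡ -1ℤ ⊎ coeff f k ≡ 0ℤ ⊎ coeff f k ≡ 1ℤ

-- For flat Φ n, the polynomials support 1ℤ (Φ n) and support -1ℤ (Φ n) are the
-- f₁ and f₂ of the unique splitting of Φ n; see splitting and splitting-unique.

ΦT : ℕ → Poly
ΦT n = support 1ℤ (Φ n) +ₚ x^ (n ℕ./ 2) *ₚ support -1ℤ (Φ n)

R : ℕ → ℕ → Poly
R n i = (x^ i *ₚ ΦT n) %ₚ (x^ n -ₚ 1ₚ)

coeff-+ₚ : ∀ f g k → coeff (f +ₚ g) k ≡ coeff f k ℤ.+ coeff g k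
coeff-+ₚ []      g       k       = sym (ℤ.+-identityˡ _)
coeff-+ₚ (a ∷ f) []      k       = sym (ℤ.+-identityʳ _)
coeff-+ₚ (a ∷ f) (b ∷ g) zero    = refl
coeff-+ₚ (a ∷ f) (b ∷ g) (suc k) = coeff-+ₚ f g k

coeff-map : ∀ (h : ℤ → ℤ) → h 0ℤ ≡ 0ℤ → ∀ f k → coeff (map h f) k ≡ h (coeff f k)
coeff-map h h0 []      k       = sym h0
coeff-map h h0 (a ∷ f) zero    = refl
coeff-map h h0 (a ∷ f) (suc k) = coeff-map h h0 f k

coeff--ₚ : ∀ f g k → coeff (f -ₚ g) k ≡ coeff f k ℤ.+ -1ℤ ℤ.* coeff g k
coeff--ₚ f g k = trans (coeff-+ₚ f (-1ℤ ·ₚ g) k)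
                      (cong (λ b → coeff f k ℤ.+ b) (coeff-map (-1ℤ ℤ.*_) refl g k))

splitting : ∀ f → Flat f → IsSplitting f (support 1ℤ f) (support -1ℤ f)
splitting f flat = record
  { difference = λ k → trans (diff (flat k))
      (sym (trans (coeff--ₚ (support 1ℤ f) (support -1ℤ f) k)
                  (cong₂ (λ a b → a ℤ.+ -1ℤ ℤ.* b) (pos k) (neg k))))
  ; ones₁      = λ k → one 1ℤ (coeff f k) (pos k)
  ; ones₂      = λ k → one -1ℤ (coeff f k) (neg k)
  ; disjoint   = λ k → disj (pos k) (neg k) (flat k)
  }
  where
  Trit : ℤ → Set
  Trit c = c ≡ -1ℤ ⊎ c ≡ 0ℤ ⊎ c ≡ 1ℤ

  pos : ∀ k → coeff (support 1ℤ f) k ≡ indicator 1ℤ (coeff f k)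
  pos = coeff-map (indicator 1ℤ) refl f

  neg : ∀ k → coeff (support -1ℤ f) k ≡ indicator -1ℤ (coeff f k)
  neg = coeff-map (indicator -1ℤ) refl f

  diff : ∀ {c} → Trit c → c ≡ indicator 1ℤ c ℤ.+ -1ℤ ℤ.* indicator -1ℤ c
  diff (inj₁ refl)        = refl
  diff (inj₂ (inj₁ refl)) = refl
  diff (inj₂ (inj₂ refl)) = refl

  one : ∀ {a} u c → a ≡ indicator u c → a ≢ 0ℤ → a ≡ 1ℤ
  one u c refl a≢0 with c ℤ.≟ u
  ... | yes _ = refl
  ... | no  _ = contradiction refl a≢0

  disj : ∀ {a b c} → a ≡ indicator 1ℤ c → b ≡ indicator -1ℤ c → Trit c →
         a ≡ 0ℤ ⊎ b ≡ 0ℤ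
  disj e _ (inj₁ refl)        = inj₁ e
  disj e _ (inj₂ (inj₁ refl)) = inj₁ e
  disj _ e (inj₂ (inj₂ refl)) = inj₂ e

splitting-unique : ∀ f f₁ f₂ → IsSplitting f f₁ f₂ →
                   f₁ ≈ support 1ℤ f × f₂ ≈ support -1ℤ f
splitting-unique f f₁ f₂ s = (λ k → proj₁ (both k)) , (λ k → proj₂ (both k))
  where
  open IsSplitting s

  cases : ∀ {a b c} → c ≡ a ℤ.+ -1ℤ ℤ.* b → (a ≢ 0ℤ → a ≡ 1ℤ) →
          (b ≢ 0ℤ → b ≡ 1ℤ) → a ≡ 0ℤ ⊎ b ≡ 0ℤ →
          a ≡ indicator 1ℤ c × b ≡ indicator -1ℤ c
  cases {a} {b} e o₁ o₂ d with a ℤ.≟ 0ℤ | b ℤ.≟ 0ℤ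
  cases e    o₁ o₂ d               | yes refl | yes refl with refl ← e = refl , refl
  cases e    o₁ o₂ d               | yes refl | no b≢0 with refl ← o₂ b≢0 | refl ← e = refl , refl
  cases e    o₁ o₂ d               | no a≢0 | yes refl with refl ← o₁ a≢0 | refl ← e = refl , refl
  cases e    o₁ o₂ (inj₁ a≡0)      | no a≢0 | no _   = contradiction a≡0 a≢0
  cases e    o₁ o₂ (inj₂ b≡0)      | no _   | no b≢0 = contradiction b≡0 b≢0

  both : ∀ k → coeff f₁ k ≡ coeff (support 1ℤ f) k × coeff f₂ k ≡ coeff (support -1ℤ f) k
  both k =
    let e₁ , e₂ = cases (trans (difference k) (coeff--ₚ f₁ f₂ k)) (ones₁ k) (ones₂ k) (disjoint k)
    in trans e₁ (sym (coeff-map (indicator 1ℤ) refl f k))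
     , trans e₂ (sym (coeff-map (indicator -1ℤ) refl f k))

{-# OPTIONS --safe #-}

-- Put t = -x, so that Φ_2pq(x) = Φ_pq(t), and let α p + β q = p q + 1 with
-- 0 < α < q and 0 < β ≤ p.  By the formula of Lam and Leung,
--   Φ_pq(t) = Σ_{i<α} Σ_{j<β} t^(ip+jq) - t Σ_{i<q-α} Σ_{j<p-β} t^(ip+jq),
-- so every k = i p + j q with i < α and j < β has coefficient (-1)^k in Φ_2pq:
-- it is an exponent of f₁ if k is even and of f₂ if k is odd.  Consecutive
-- ones of the same parity differ by at most 2 p + q - 2.  The even ones run from
-- 0 to φ(n), the odd ones from p to φ(n) - p, and f₁ and f₂ have no exponents
-- outside these ranges.  So among the residues modulo n the exponents of Φ_n^T
-- leave exactly two runs of 2 p + q - 2 consecutive absent ones, from φ(n) + 1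
-- to n / 2 + p - 1 and from n / 2 + φ(n) - p + 1 to n - 1, and only the shifts
-- i = n / 2 - p and i = 0 put such a run at the top.

module Submission where

-- Put m = n - i and W = 2 p + q - 2, so that deg Φ_n^T = n - 1 - W. If some exponent e of Φ_n^T
-- satisfies m - W ≤ e < m, then x^i carries e to i + e < n without wrapping, and i + e > deg Φ_n^T.
-- Part (1) is therefore a search for one exponent in each window of length W, and the points i p +
-- j q supply it. Part (2) needs absent exponents instead, and these come from signs rather than
-- from the double sums. Since p and q are odd, t = -x turns the product formula into (1 + x^p) (1 +
-- x^q) Φ_n = (1 + x) (1 + x^(pq)). The right side has nonnegative coefficients. Near either end of
-- Φ_n the factors on the left only copy its coefficients, so Φ_n has no negative coefficient below
-- p or above φ(n) - p. The definition of Φ divides x^n - 1 by a product over all proper divisors.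
-- An explicit formula is recognised as Φ_n by multiplying it with the known Φ_d: division by a
-- monic polynomial is exact and has a unique quotient. Monicity must therefore be carried along
-- from divisor to divisor.

open import Defs
open import Algebra.Bundles using (CommutativeRing)
import Algebra.Properties.Semiring.Exp as Exp
open import Data.Bool.Base using (true; false; if_then_else_)
open import Data.Integer.Base as ℤ using (ℤ; 0ℤ; 1ℤ; -1ℤ; +≤+)
import Data.Integer.Properties as ℤ
import Data.Integer.Solver as ℤ-Solver
open import Data.List.Base using (List; []; _∷_; _++_; map; filter; length; upTo; applyDownFrom)
open import Data.List.Membership.Propositional using (_∈_)
import Data.List.Membership.Propositional.Properties as ∈
open import Data.List.Membership.Propositional.Properties.WithK using (unique∧set⇒bag)
import Data.List.Properties as List
open import Data.List.Relation.Binary.BagAndSetEquality using (∼bag⇒↭)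
open import Data.List.Relation.Binary.Permutation.Propositional as ↭ using (_↭_)
import Data.List.Relation.Binary.Permutation.Propositional.Properties as ↭
open import Data.List.Relation.Unary.All as All using (All; []; _∷_; all?)
open import Data.List.Relation.Unary.AllPairs as AllPairs using ([]; _∷_)
open import Data.List.Relation.Unary.Any using (here; there)
open import Data.List.Relation.Unary.Linked using ([-]; _∷_)
open import Data.List.Relation.Unary.Linked.Properties using (Linked⇒AllPairs)
open import Data.List.Relation.Unary.Unique.Propositional using (Unique)
import Data.List.Relation.Unary.Unique.Propositional.Properties as Unique
open import Data.Maybe.Base using (Maybe; just; nothing)
open import Data.Nat.Base as ℕ using (ℕ; zero; suc; _+_; _*_; _∸_; _/_; _≤_; _<_; _>_; z≤n; s≤s; z<s; s<s; NonZero)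
open import Data.Nat.Coprimality as Coprime using (Coprime; coprime?; coprime-Bézout; coprime-divisor)
open import Data.Nat.Divisibility as ∣ using (_∣_; _∤_; _∣?_; divides)
open import Data.Nat.DivMod using (m≡m%n+[m/n]*n; m%n<n; m*n/n≡m)
open import Data.Nat.GCD using (module Bézout)
open import Data.Nat.Primality using (Prime; prime⇒irreducible; prime⇒nonZero; prime⇒nonTrivial; prime[2])
import Data.Nat.Properties as ℕ
import Data.Nat.Tactic.RingSolver as ℕSolver
open import Data.Product.Base using (_×_; _,_; proj₁; proj₂; ∃; ∃-syntax)
open import Data.Sum.Base using (_⊎_; inj₁; inj₂)
open import Function.Base using (_∘_; _$_; case_of_)
open import Function.Bundles using (mk⇔)
open import Level using (0ℓ)
open import Relation.Binary.Definitions using (tri<; tri≈; tri>)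
open import Relation.Binary.PropositionalEquality using (_≡_; _≢_; refl; sym; trans; cong; cong₂; subst; module ≡-Reasoning)
import Relation.Binary.Reasoning.Setoid as SetoidReasoning
open import Relation.Nullary using (Dec; yes; no; contradiction; ¬_)
open import Relation.Nullary.Decidable using (does; does-⇔)
open import Relation.Unary using (Pred; Decidable)
open import Tactic.RingSolver using (solve-∀)
open import Tactic.RingSolver.Core.AlmostCommutativeRing using (AlmostCommutativeRing; fromCommutativeRing)

open ℤ-Solver.+-*-Solver using (solve; _:+_; _:*_; _:=_; con)

-- The ring ℤ[x]

-- _≈_ unfolds to a function type, from which f and g cannot be inferred; the
-- record makes them inferable.
infix 4 _≋_

record _≋_ (f g : Poly) : Set where
  constructor ⟨_⟩
  field
    at : f ≈ g

open _≋_

≋-refl : ∀ {f} → f ≋ f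
≋-refl = ⟨ (λ k → refl) ⟩

≋-sym : ∀ {f g} → f ≋ g → g ≋ f
≋-sym e = ⟨ (λ k → sym (at e k)) ⟩

≋-trans : ∀ {f g h} → f ≋ g → g ≋ h → f ≋ h
≋-trans e e′ = ⟨ (λ k → trans (at e k) (at e′ k)) ⟩

∷-cong : ∀ {a f g} → f ≋ g → a ∷ f ≋ a ∷ g
∷-cong e = ⟨ (λ { zero → refl ; (suc k) → at e k }) ⟩

∷-≋[] : ∀ {a f} → a ≡ 0ℤ → f ≋ [] → a ∷ f ≋ []
∷-≋[] e e′ = ⟨ (λ { zero → e ; (suc k) → at e′ k }) ⟩

coeff-·ₚ : ∀ c f k → coeff (c ·ₚ f) k ≡ c ℤ.* coeff f k
coeff-·ₚ c f k = coeff-map (c ℤ.*_) (ℤ.*-zeroʳ c) f k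

+ₚ-cong : ∀ {f f′ g g′} → f ≋ f′ → g ≋ g′ → f +ₚ g ≋ f′ +ₚ g′
+ₚ-cong {f} {f′} {g} {g′} e e′ = ⟨ (λ k → trans (coeff-+ₚ f g k)
  (trans (cong₂ ℤ._+_ (at e k) (at e′ k)) (sym (coeff-+ₚ f′ g′ k)))) ⟩

·ₚ-cong : ∀ c {f g} → f ≋ g → c ·ₚ f ≋ c ·ₚ g
·ₚ-cong c {f} {g} e = ⟨ (λ k → trans (coeff-·ₚ c f k)
  (trans (cong (c ℤ.*_) (at e k)) (sym (coeff-·ₚ c g k)))) ⟩

+ₚ-assoc : ∀ f g h → (f +ₚ g) +ₚ h ≋ f +ₚ (g +ₚ h)
+ₚ-assoc f g h = ⟨ assoc ⟩
  where
  assoc : (f +ₚ g) +ₚ h ≈ f +ₚ (g +ₚ h)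
  assoc k rewrite coeff-+ₚ (f +ₚ g) h k | coeff-+ₚ f g k | coeff-+ₚ f (g +ₚ h) k | coeff-+ₚ g h k =
    ℤ.+-assoc (coeff f k) _ _

+ₚ-comm : ∀ f g → f +ₚ g ≋ g +ₚ f
+ₚ-comm f g = ⟨ (λ k → trans (coeff-+ₚ f g k)
  (trans (ℤ.+-comm (coeff f k) _) (sym (coeff-+ₚ g f k)))) ⟩

+ₚ-identityʳ : ∀ f → f +ₚ [] ≋ f
+ₚ-identityʳ f = ⟨ (λ k → trans (coeff-+ₚ f [] k) (ℤ.+-identityʳ _)) ⟩

·ₚ-zeroˡ : ∀ f → 0ℤ ·ₚ f ≋ []
·ₚ-zeroˡ f = ⟨ (λ k → trans (coeff-·ₚ 0ℤ f k) (ℤ.*-zeroˡ (coeff f k))) ⟩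

+ₚ-inverseʳ : ∀ f → f -ₚ f ≋ []
+ₚ-inverseʳ f = ⟨ (λ k → trans (coeff--ₚ f f k)
  (solve 1 (λ a → a :+ con -1ℤ :* a := con 0ℤ) refl (coeff f k))) ⟩

coeff-*ₚ-zero : ∀ a f g → coeff ((a ∷ f) *ₚ g) 0 ≡ a ℤ.* coeff g 0
coeff-*ₚ-zero a f g = trans (coeff-+ₚ (a ·ₚ g) _ 0)
  (trans (ℤ.+-identityʳ _) (coeff-·ₚ a g 0))

coeff-*ₚ-suc : ∀ a f g k → coeff ((a ∷ f) *ₚ g) (suc k) ≡ a ℤ.* coeff g (suc k) ℤ.+ coeff (f *ₚ g) k
coeff-*ₚ-suc a f g k = trans (coeff-+ₚ (a ·ₚ g) _ (suc k))
  (cong (ℤ._+ coeff (f *ₚ g) k) (coeff-·ₚ a g (suc k)))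

*ₚ-zeroʳ : ∀ f → f *ₚ [] ≋ []
*ₚ-zeroʳ []      = ≋-refl
*ₚ-zeroʳ (a ∷ f) = ∷-≋[] refl (*ₚ-zeroʳ f)

*ₚ-congˡ : ∀ f {g h} → g ≋ h → f *ₚ g ≋ f *ₚ h
*ₚ-congˡ []      e = ≋-refl
*ₚ-congˡ (a ∷ f) e = +ₚ-cong (·ₚ-cong a e) (∷-cong (*ₚ-congˡ f e))

-- The defining recursion of the product, transferred to its right argument. Commutativity is then a
-- plain induction.
*ₚ-∷ : ∀ f b g → f *ₚ (b ∷ g) ≋ b ·ₚ f +ₚ (0ℤ ∷ f *ₚ g)
*ₚ-∷ []      b g = ≋-sym (∷-≋[] refl ≋-refl)
*ₚ-∷ (a ∷ f) b g = ⟨ eq ⟩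
  where
  eq : (a ∷ f) *ₚ (b ∷ g) ≈ b ·ₚ (a ∷ f) +ₚ (0ℤ ∷ (a ∷ f) *ₚ g)
  eq zero    = cong (ℤ._+ 0ℤ) (ℤ.*-comm a b)
  eq (suc k)
    rewrite coeff-+ₚ (a ·ₚ g) (f *ₚ (b ∷ g)) k | at (*ₚ-∷ f b g) k
          | coeff-+ₚ (b ·ₚ f) (0ℤ ∷ f *ₚ g) k
          | coeff-+ₚ (b ·ₚ f) (a ·ₚ g +ₚ (0ℤ ∷ f *ₚ g)) k
          | coeff-+ₚ (a ·ₚ g) (0ℤ ∷ f *ₚ g) k =
    solve 3 (λ x y z → x :+ (y :+ z) := y :+ (x :+ z)) refl
      (coeff (a ·ₚ g) k) (coeff (b ·ₚ f) k) (coeff (0ℤ ∷ f *ₚ g) k)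

*ₚ-comm : ∀ f g → f *ₚ g ≋ g *ₚ f
*ₚ-comm []      g = ≋-sym (*ₚ-zeroʳ g)
*ₚ-comm (a ∷ f) g = ≋-trans (+ₚ-cong ≋-refl (∷-cong (*ₚ-comm f g))) (≋-sym (*ₚ-∷ g a f))

*ₚ-cong : ∀ {f f′ g g′} → f ≋ f′ → g ≋ g′ → f *ₚ g ≋ f′ *ₚ g′
*ₚ-cong {f} {f′} {g} {g′} e e′ = ≋-trans (*ₚ-congˡ f e′)
  (≋-trans (*ₚ-comm f g′) (≋-trans (*ₚ-congˡ g′ e) (*ₚ-comm g′ f′)))

*ₚ-distribˡ : ∀ f g h → f *ₚ (g +ₚ h) ≋ f *ₚ g +ₚ f *ₚ h
*ₚ-distribˡ []      g h = ≋-refl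
*ₚ-distribˡ (a ∷ f) g h = ⟨ eq ⟩
  where
  eq : (a ∷ f) *ₚ (g +ₚ h) ≈ (a ∷ f) *ₚ g +ₚ (a ∷ f) *ₚ h
  eq zero
    rewrite coeff-+ₚ ((a ∷ f) *ₚ g) ((a ∷ f) *ₚ h) 0
          | coeff-*ₚ-zero a f (g +ₚ h) | coeff-*ₚ-zero a f g | coeff-*ₚ-zero a f h
          | coeff-+ₚ g h 0 = ℤ.*-distribˡ-+ a _ _
  eq (suc k)
    rewrite coeff-+ₚ ((a ∷ f) *ₚ g) ((a ∷ f) *ₚ h) (suc k)
          | coeff-*ₚ-suc a f (g +ₚ h) k | coeff-*ₚ-suc a f g k | coeff-*ₚ-suc a f h k
          | coeff-+ₚ g h (suc k) | at (*ₚ-distribˡ f g h) k | coeff-+ₚ (f *ₚ g) (f *ₚ h) k =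
    solve 5 (λ a x y u v → a :* (x :+ y) :+ (u :+ v) := (a :* x :+ u) :+ (a :* y :+ v)) refl
      a (coeff g (suc k)) (coeff h (suc k)) (coeff (f *ₚ g) k) (coeff (f *ₚ h) k)

*ₚ-distribʳ : ∀ h f g → (f +ₚ g) *ₚ h ≋ f *ₚ h +ₚ g *ₚ h
*ₚ-distribʳ h f g = ≋-trans (*ₚ-comm (f +ₚ g) h)
  (≋-trans (*ₚ-distribˡ h f g) (+ₚ-cong (*ₚ-comm h f) (*ₚ-comm h g)))

·ₚ-*ₚ-assoc : ∀ c f g → (c ·ₚ f) *ₚ g ≋ c ·ₚ (f *ₚ g)
·ₚ-*ₚ-assoc c []      g = ≋-refl
·ₚ-*ₚ-assoc c (a ∷ f) g = ⟨ eq ⟩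
  where
  eq : (c ·ₚ (a ∷ f)) *ₚ g ≈ c ·ₚ ((a ∷ f) *ₚ g)
  eq zero
    rewrite coeff-*ₚ-zero (c ℤ.* a) (c ·ₚ f) g | coeff-·ₚ c ((a ∷ f) *ₚ g) 0 | coeff-*ₚ-zero a f g =
    ℤ.*-assoc c a _
  eq (suc k)
    rewrite coeff-*ₚ-suc (c ℤ.* a) (c ·ₚ f) g k | coeff-·ₚ c ((a ∷ f) *ₚ g) (suc k) | coeff-*ₚ-suc a f g k
          | at (·ₚ-*ₚ-assoc c f g) k | coeff-·ₚ c (f *ₚ g) k =
    solve 4 (λ c a x u → c :* a :* x :+ c :* u := c :* (a :* x :+ u)) refl
      c a (coeff g (suc k)) (coeff (f *ₚ g) k)

0∷-*ₚ : ∀ f g → (0ℤ ∷ f) *ₚ g ≋ 0ℤ ∷ f *ₚ g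
0∷-*ₚ f g = +ₚ-cong (·ₚ-zeroˡ g) ≋-refl

*ₚ-assoc : ∀ f g h → (f *ₚ g) *ₚ h ≋ f *ₚ (g *ₚ h)
*ₚ-assoc []      g h = ≋-refl
*ₚ-assoc (a ∷ f) g h = ≋-trans (*ₚ-distribʳ h (a ·ₚ g) (0ℤ ∷ f *ₚ g))
  (+ₚ-cong (·ₚ-*ₚ-assoc a g h) (≋-trans (0∷-*ₚ (f *ₚ g) h) (∷-cong (*ₚ-assoc f g h))))

*ₚ-identityˡ : ∀ f → 1ₚ *ₚ f ≋ f
*ₚ-identityˡ f = ⟨ (λ
  { zero    → trans (coeff-*ₚ-zero 1ℤ [] f) (ℤ.*-identityˡ _)
  ; (suc k) → trans (coeff-*ₚ-suc 1ℤ [] f k) (trans (ℤ.+-identityʳ _) (ℤ.*-identityˡ _)) }) ⟩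

polyRing : CommutativeRing 0ℓ 0ℓ
polyRing = record
  { Carrier = Poly ; _≈_ = _≋_ ; _+_ = _+ₚ_ ; _*_ = _*ₚ_ ; -_ = -1ℤ ·ₚ_ ; 0# = [] ; 1# = 1ₚ
  ; isCommutativeRing = record
    { isRing = record
      { +-isAbelianGroup = record
        { isGroup = record
          { isMonoid = record
            { isSemigroup = record
              { isMagma = record
                { isEquivalence = record { refl = ≋-refl ; sym = ≋-sym ; trans = ≋-trans }
                ; ∙-cong = +ₚ-cong }
              ; assoc = +ₚ-assoc }
            ; identity = (λ f → ≋-refl) , +ₚ-identityʳ }
          ; inverse = (λ f → ≋-trans (+ₚ-comm (-1ℤ ·ₚ f) f) (+ₚ-inverseʳ f)) , +ₚ-inverseʳ
          ; ⁻¹-cong = ·ₚ-cong -1ℤ }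
        ; comm = +ₚ-comm }
      ; *-cong = *ₚ-cong
      ; *-assoc = *ₚ-assoc
      ; *-identity = *ₚ-identityˡ , λ f → ≋-trans (*ₚ-comm f 1ₚ) (*ₚ-identityˡ f)
      ; distrib = *ₚ-distribˡ , *ₚ-distribʳ }
    ; *-comm = *ₚ-comm } }

All-0⇒≋[] : ∀ {f} → All (_≡ 0ℤ) f → f ≋ []
All-0⇒≋[] []       = ≋-refl
All-0⇒≋[] (e ∷ es) = ∷-≋[] e (All-0⇒≋[] es)

≈[]⇒All-0 : ∀ f → f ≈ [] → All (_≡ 0ℤ) f
≈[]⇒All-0 []      e = []
≈[]⇒All-0 (a ∷ f) e = e 0 ∷ ≈[]⇒All-0 f (e ∘ suc)

-- The zero test lets `solve-∀` recognise coefficients that cancel.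
polyACR : AlmostCommutativeRing 0ℓ 0ℓ
polyACR = fromCommutativeRing polyRing 0≟ₚ
  where
  0≟ₚ : ∀ f → Maybe ([] ≋ f)
  0≟ₚ f with all? (ℤ._≟ 0ℤ) f
  ... | yes z = just (≋-sym (All-0⇒≋[] z))
  ... | no  _ = nothing

-- Geometric sums and the Lam–Leung polynomial

open CommutativeRing polyRing using (semiring; setoid)
open Exp semiring using (^-homo-*; ^-assocʳ) renaming (_^_ to infixr 8 _^ₚ_)
module ≋-Reasoning = SetoidReasoning setoid

geo : ℕ → Poly → Poly
geo zero    X = []
geo (suc m) X = 1ₚ +ₚ X *ₚ geo m X

geo-sum : ∀ m X → (1ₚ -ₚ X) *ₚ geo m X ≋ 1ₚ -ₚ X ^ₚ m
geo-sum zero    X = ≋-trans (*ₚ-zeroʳ (1ₚ -ₚ X)) (≋-sym (∷-≋[] refl ≋-refl))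
geo-sum (suc m) X = begin
  (1ₚ -ₚ X) *ₚ (1ₚ +ₚ X *ₚ geo m X)            ≈⟨ expand X (geo m X) ⟩
  (1ₚ -ₚ X) +ₚ X *ₚ ((1ₚ -ₚ X) *ₚ geo m X)    ≈⟨ +ₚ-cong ≋-refl (*ₚ-congˡ X (geo-sum m X)) ⟩
  (1ₚ -ₚ X) +ₚ X *ₚ (1ₚ -ₚ X ^ₚ m)            ≈⟨ collect X (X ^ₚ m) ⟩
  1ₚ -ₚ X *ₚ X ^ₚ m                           ∎
  where
  open ≋-Reasoning
  expand : ∀ X g → (1ₚ -ₚ X) *ₚ (1ₚ +ₚ X *ₚ g) ≋ (1ₚ -ₚ X) +ₚ X *ₚ ((1ₚ -ₚ X) *ₚ g)
  expand = solve-∀ polyACR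
  collect : ∀ X Y → (1ₚ -ₚ X) +ₚ X *ₚ (1ₚ -ₚ Y) ≋ 1ₚ -ₚ X *ₚ Y
  collect = solve-∀ polyACR

-- The last two equations say α p + β q = p q + 1.
record Inverses (p q : ℕ) : Set where
  constructor inverses
  field
    α α′ β β′ : ℕ
    α+α′≡q    : α ℕ.+ α′ ≡ q
    β+β′≡p    : β ℕ.+ β′ ≡ p
    αp≡1+β′q  : α ℕ.* p ≡ suc (β′ ℕ.* q)
    βq≡1+α′p  : β ℕ.* q ≡ suc (α′ ℕ.* p)

module Lam-Leung {p q : ℕ} (I : Inverses p q) where

  open Inverses I

  Ψ : Poly → Poly
  Ψ t = geo α (t ^ₚ p) *ₚ geo β (t ^ₚ q) -ₚ t *ₚ (geo α′ (t ^ₚ p) *ₚ geo β′ (t ^ₚ q))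

  module _ (t : Poly) where
    private
      X Y A A′ B B′ : Poly
      X = t ^ₚ p
      Y = t ^ₚ q
      A = X ^ₚ α
      A′ = X ^ₚ α′
      B = Y ^ₚ β
      B′ = Y ^ₚ β′

      -- The two equations of `Inverses`, read in the exponents of t, become `t A′ = B` and
      -- `t B′ = A`.
      power-swap : ∀ m n a b → a ℕ.* m ≡ suc (b ℕ.* n) → t *ₚ (t ^ₚ n) ^ₚ b ≋ (t ^ₚ m) ^ₚ a
      power-swap m n a b e = begin
        t *ₚ (t ^ₚ n) ^ₚ b   ≈⟨ *ₚ-congˡ t (^-assocʳ t n b) ⟩
        t ^ₚ (suc (n ℕ.* b)) ≡⟨ cong (t ^ₚ_) (trans (cong suc (ℕ.*-comm n b)) (trans (sym e) (ℕ.*-comm a m))) ⟩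
        t ^ₚ (m ℕ.* a)       ≈⟨ ≋-sym (^-assocʳ t m a) ⟩
        (t ^ₚ m) ^ₚ a        ∎
        where open ≋-Reasoning

      tA′≋B : t *ₚ A′ ≋ B
      tA′≋B = power-swap q p β α′ βq≡1+α′p

      tB′≋A : t *ₚ B′ ≋ A
      tB′≋A = power-swap p q α β′ αp≡1+β′q

      B′B≋ : B′ *ₚ B ≋ t ^ₚ (p ℕ.* q)
      B′B≋ = begin
        B′ *ₚ B            ≈⟨ *ₚ-comm B′ B ⟩
        B *ₚ B′            ≈⟨ ≋-sym (^-homo-* Y β β′) ⟩
        Y ^ₚ (β ℕ.+ β′)    ≡⟨ cong (Y ^ₚ_) β+β′≡p ⟩
        Y ^ₚ p             ≈⟨ ^-assocʳ t q p ⟩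
        t ^ₚ (q ℕ.* p)     ≡⟨ cong (t ^ₚ_) (ℕ.*-comm q p) ⟩
        t ^ₚ (p ℕ.* q)     ∎
        where open ≋-Reasoning

    -- Telescoping turns every `geo` into 1 minus a power. In the expansion `t A′` cancels `B` and
    -- `t B′` cancels `A`; what is left is 1 - t + t B′ B - B B′, which factors.
    Ψ-factors : (1ₚ -ₚ t ^ₚ p) *ₚ ((1ₚ -ₚ t ^ₚ q) *ₚ Ψ t) ≋ (1ₚ -ₚ t) *ₚ (1ₚ -ₚ t ^ₚ (p ℕ.* q))
    Ψ-factors = begin
      (1ₚ -ₚ X) *ₚ ((1ₚ -ₚ Y) *ₚ Ψ t)
        ≈⟨ regroup (1ₚ -ₚ X) (1ₚ -ₚ Y) t (geo α X) (geo β Y) (geo α′ X) (geo β′ Y) ⟩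
      ((1ₚ -ₚ X) *ₚ geo α X) *ₚ ((1ₚ -ₚ Y) *ₚ geo β Y)
        -ₚ t *ₚ (((1ₚ -ₚ X) *ₚ geo α′ X) *ₚ ((1ₚ -ₚ Y) *ₚ geo β′ Y))
        ≈⟨ +ₚ-cong (*ₚ-cong (geo-sum α X) (geo-sum β Y))
             (·ₚ-cong -1ℤ (*ₚ-congˡ t (*ₚ-cong (geo-sum α′ X) (geo-sum β′ Y)))) ⟩
      (1ₚ -ₚ A) *ₚ (1ₚ -ₚ B) -ₚ t *ₚ ((1ₚ -ₚ A′) *ₚ (1ₚ -ₚ B′))
        ≈⟨ expand A B t A′ B′ ⟩
      1ₚ -ₚ t +ₚ (t *ₚ A′ -ₚ B) +ₚ (t *ₚ B′ -ₚ A) +ₚ (A *ₚ B -ₚ (t *ₚ A′) *ₚ B′)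
        ≈⟨ +ₚ-cong (+ₚ-cong (+ₚ-cong (≋-refl {1ₚ -ₚ t}) (+ₚ-cong tA′≋B ≋-refl)) (+ₚ-cong tB′≋A ≋-refl))
             (+ₚ-cong (*ₚ-cong (≋-sym tB′≋A) ≋-refl) (·ₚ-cong -1ℤ (*ₚ-cong tA′≋B ≋-refl))) ⟩
      1ₚ -ₚ t +ₚ (B -ₚ B) +ₚ (A -ₚ A) +ₚ ((t *ₚ B′) *ₚ B -ₚ B *ₚ B′)
        ≈⟨ collect t A B B′ ⟩
      (1ₚ -ₚ t) *ₚ (1ₚ -ₚ B′ *ₚ B)
        ≈⟨ *ₚ-congˡ (1ₚ -ₚ t) (+ₚ-cong (≋-refl {1ₚ}) (·ₚ-cong -1ℤ B′B≋)) ⟩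
      (1ₚ -ₚ t) *ₚ (1ₚ -ₚ t ^ₚ (p ℕ.* q)) ∎
      where
      open ≋-Reasoning
      regroup : ∀ x y t a b a′ b′ → x *ₚ (y *ₚ (a *ₚ b -ₚ t *ₚ (a′ *ₚ b′))) ≋
                (x *ₚ a) *ₚ (y *ₚ b) -ₚ t *ₚ ((x *ₚ a′) *ₚ (y *ₚ b′))
      regroup = solve-∀ polyACR
      expand : ∀ A B t A′ B′ → (1ₚ -ₚ A) *ₚ (1ₚ -ₚ B) -ₚ t *ₚ ((1ₚ -ₚ A′) *ₚ (1ₚ -ₚ B′)) ≋
               1ₚ -ₚ t +ₚ (t *ₚ A′ -ₚ B) +ₚ (t *ₚ B′ -ₚ A) +ₚ (A *ₚ B -ₚ (t *ₚ A′) *ₚ B′)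
      expand = solve-∀ polyACR
      collect : ∀ t A B B′ → 1ₚ -ₚ t +ₚ (B -ₚ B) +ₚ (A -ₚ A) +ₚ ((t *ₚ B′) *ₚ B -ₚ B *ₚ B′) ≋
                (1ₚ -ₚ t) *ₚ (1ₚ -ₚ B′ *ₚ B)
      collect = solve-∀ polyACR

    -- The factor 1 - t can be cancelled only for t whose 1 - t is monic up to sign.
    Ψ-product : (1ₚ -ₚ t) *ₚ ((1ₚ -ₚ t) *ₚ geo p t *ₚ geo q t *ₚ Ψ t) ≋
                (1ₚ -ₚ t) *ₚ (1ₚ -ₚ t ^ₚ (p ℕ.* q))
    Ψ-product = begin
      (1ₚ -ₚ t) *ₚ ((1ₚ -ₚ t) *ₚ geo p t *ₚ geo q t *ₚ Ψ t)
        ≈⟨ regroup (1ₚ -ₚ t) (geo p t) (geo q t) (Ψ t) ⟩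
      ((1ₚ -ₚ t) *ₚ geo p t) *ₚ (((1ₚ -ₚ t) *ₚ geo q t) *ₚ Ψ t)
        ≈⟨ *ₚ-cong (geo-sum p t) (*ₚ-cong (geo-sum q t) ≋-refl) ⟩
      (1ₚ -ₚ X) *ₚ ((1ₚ -ₚ Y) *ₚ Ψ t)
        ≈⟨ Ψ-factors ⟩
      (1ₚ -ₚ t) *ₚ (1ₚ -ₚ t ^ₚ (p ℕ.* q)) ∎
      where
      open ≋-Reasoning
      regroup : ∀ u a b c → u *ₚ (u *ₚ a *ₚ b *ₚ c) ≋ (u *ₚ a) *ₚ ((u *ₚ b) *ₚ c)
      regroup = solve-∀ polyACR

-- Monic polynomials and division

-- The monomial s x. With s = 1 and s = -1 it treats powers of x and of -x together.
linear : ℤ → Poly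
linear s = 0ℤ ∷ s ∷ []

coeff-linear-*ₚ : ∀ s f k → coeff (linear s *ₚ f) (suc k) ≡ s ℤ.* coeff f k
coeff-linear-*ₚ s f k = trans (at (0∷-*ₚ (s ∷ []) f) (suc k)) (lemma k)
  where
  lemma : ∀ k → coeff ((s ∷ []) *ₚ f) k ≡ s ℤ.* coeff f k
  lemma zero    = coeff-*ₚ-zero s [] f
  lemma (suc k) = trans (coeff-*ₚ-suc s [] f k) (ℤ.+-identityʳ _)

coeff-linear^-*ₚ : ∀ s m f l → coeff (linear s ^ₚ m *ₚ f) (m ℕ.+ l) ≡ s ℤ.^ m ℤ.* coeff f l
coeff-linear^-*ₚ s zero    f l = trans (at (*ₚ-identityˡ f) l) (sym (ℤ.*-identityˡ _))
coeff-linear^-*ₚ s (suc m) f l = begin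
  coeff (linear s *ₚ linear s ^ₚ m *ₚ f) (suc (m ℕ.+ l))
    ≡⟨ at (*ₚ-assoc (linear s) (linear s ^ₚ m) f) (suc (m ℕ.+ l)) ⟩
  coeff (linear s *ₚ (linear s ^ₚ m *ₚ f)) (suc (m ℕ.+ l))
    ≡⟨ coeff-linear-*ₚ s (linear s ^ₚ m *ₚ f) (m ℕ.+ l) ⟩
  s ℤ.* coeff (linear s ^ₚ m *ₚ f) (m ℕ.+ l)
    ≡⟨ cong (s ℤ.*_) (coeff-linear^-*ₚ s m f l) ⟩
  s ℤ.* (s ℤ.^ m ℤ.* coeff f l)
    ≡⟨ ℤ.*-assoc s _ _ ⟨
  s ℤ.^ suc m ℤ.* coeff f l ∎
  where open ≡-Reasoning

coeff-linear^-*ₚ-< : ∀ s m f {k} → k < m → coeff (linear s ^ₚ m *ₚ f) k ≡ 0ℤ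
coeff-linear^-*ₚ-< s (suc m) f {zero}  _ =
  trans (at (*ₚ-assoc (linear s) (linear s ^ₚ m) f) 0) (at (0∷-*ₚ (s ∷ []) (linear s ^ₚ m *ₚ f)) 0)
coeff-linear^-*ₚ-< s (suc m) f {suc k} (s<s k<m) = begin
  coeff (linear s *ₚ linear s ^ₚ m *ₚ f) (suc k)
    ≡⟨ at (*ₚ-assoc (linear s) (linear s ^ₚ m) f) (suc k) ⟩
  coeff (linear s *ₚ (linear s ^ₚ m *ₚ f)) (suc k)
    ≡⟨ coeff-linear-*ₚ s (linear s ^ₚ m *ₚ f) k ⟩
  s ℤ.* coeff (linear s ^ₚ m *ₚ f) k
    ≡⟨ cong (s ℤ.*_) (coeff-linear^-*ₚ-< s m f k<m) ⟩
  s ℤ.* 0ℤ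
    ≡⟨ ℤ.*-zeroʳ s ⟩
  0ℤ ∎
  where open ≡-Reasoning

coeff-linear^ : ∀ s m → coeff (linear s ^ₚ m) m ≡ s ℤ.^ m
coeff-linear^ s m = begin
  coeff (linear s ^ₚ m) m                     ≡⟨ at *1ₚ m ⟨
  coeff (linear s ^ₚ m *ₚ 1ₚ) m               ≡⟨ cong (coeff (linear s ^ₚ m *ₚ 1ₚ)) (ℕ.+-identityʳ m) ⟨
  coeff (linear s ^ₚ m *ₚ 1ₚ) (m ℕ.+ 0)       ≡⟨ coeff-linear^-*ₚ s m 1ₚ 0 ⟩
  s ℤ.^ m ℤ.* 1ℤ                              ≡⟨ ℤ.*-identityʳ _ ⟩
  s ℤ.^ m                                     ∎
  where
  open ≡-Reasoning
  *1ₚ = ≋-trans (*ₚ-comm (linear s ^ₚ m) 1ₚ) (*ₚ-identityˡ (linear s ^ₚ m))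

coeff-linear^-≢ : ∀ s m {k} → k ≢ m → coeff (linear s ^ₚ m) k ≡ 0ℤ
coeff-linear^-≢ s zero    {zero}  k≢m = contradiction refl k≢m
coeff-linear^-≢ s zero    {suc k} k≢m = refl
coeff-linear^-≢ s (suc m) {zero}  k≢m = at (0∷-*ₚ (s ∷ []) (linear s ^ₚ m)) 0
coeff-linear^-≢ s (suc m) {suc k} k≢m = trans (coeff-linear-*ₚ s (linear s ^ₚ m) k)
  (trans (cong (s ℤ.*_) (coeff-linear^-≢ s m (k≢m ∘ cong suc))) (ℤ.*-zeroʳ s))

x^≋linear^ : ∀ m → x^ m ≋ linear 1ℤ ^ₚ m
x^≋linear^ zero    = ≋-refl
x^≋linear^ (suc m) = ⟨ (λ
  { zero    → sym (at (0∷-*ₚ (1ℤ ∷ []) (linear 1ℤ ^ₚ m)) 0)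
  ; (suc k) → sym (trans (coeff-linear-*ₚ 1ℤ (linear 1ℤ ^ₚ m) k) (trans (ℤ.*-identityˡ _) (sym (at (x^≋linear^ m) k)))) }) ⟩

-- Stated through coefficients, so that it is invariant under `≋`; `deg-≡` links it to `deg`.
Lead : Poly → ℕ → Set
Lead f d = coeff f d ≡ 1ℤ × (∀ k → d < k → coeff f k ≡ 0ℤ)

Monic : Poly → Set
Monic f = ∃ (Lead f)

Monic-resp-≋ : ∀ {f g} → f ≋ g → Monic f → Monic g
Monic-resp-≋ e (d , l , v) = d , trans (sym (at e d)) l , λ k d<k → trans (sym (at e k)) (v k d<k)

≤-suc-pred : ∀ m → m ≤ suc (ℕ.pred m)
≤-suc-pred zero    = z≤n
≤-suc-pred (suc m) = ℕ.≤-refl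

tail≋[] : ∀ {a u m} → (∀ k → m ≤ k → coeff (a ∷ u) k ≡ 0ℤ) → m ≤ 1 → u ≋ []
tail≋[] v m≤1 = ⟨ (λ k → v (suc k) (ℕ.≤-trans m≤1 (s≤s z≤n))) ⟩

module _ {g d} (lead : Lead g d) where
  private
    leading = proj₁ lead
    above   = proj₂ lead

    coeff-const : ∀ a {u} → u ≋ [] → coeff ((a ∷ u) *ₚ g) d ≡ a
    coeff-const a {u} u≋[] = trans (coeff-+ₚ (a ·ₚ g) _ d)
      (trans (cong₂ ℤ._+_ (trans (coeff-·ₚ a g d) (trans (cong (a ℤ.*_) leading) (ℤ.*-identityʳ a)))
                          (at (∷-≋[] refl (*ₚ-cong u≋[] (≋-refl {g}))) d))
             (ℤ.+-identityʳ a))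

    coeff-above : ∀ a u k → d ≤ k → coeff ((a ∷ u) *ₚ g) (suc k) ≡ coeff (u *ₚ g) k
    coeff-above a u k d≤k = trans (coeff-*ₚ-suc a u g k)
      (trans (cong (λ z → a ℤ.* z ℤ.+ coeff (u *ₚ g) k) (above (suc k) (s≤s d≤k)))
             (trans (cong (ℤ._+ coeff (u *ₚ g) k) (ℤ.*-zeroʳ a)) (ℤ.+-identityˡ _)))

  -- As `g` is monic, the top coefficient of `u` reappears in the product `d` places higher. For m =
  -- 0 this says that a multiple of `g` of degree below `d` is zero, the source of cancellation and
  -- of unique quotients. The recursion clears the tail of `u` first; the constant term is then
  -- visible at `d`.
  *ₚ-vanish⁻ : ∀ u m → (∀ k → m ℕ.+ d ≤ k → coeff (u *ₚ g) k ≡ 0ℤ) →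
               ∀ k → m ≤ k → coeff u k ≡ 0ℤ
  *ₚ-vanish⁻ []      m v k       m≤k = refl
  *ₚ-vanish⁻ (a ∷ u) m v = λ where
      zero    z≤n → trans (sym (coeff-const a {u} ⟨ (λ k → v′ k z≤n) ⟩)) (v d ℕ.≤-refl)
      (suc k) m≤k → v′ k (ℕ.pred-mono-≤ m≤k)
    where
    v′ : ∀ k → ℕ.pred m ≤ k → coeff u k ≡ 0ℤ
    v′ = *ₚ-vanish⁻ u (ℕ.pred m) λ k le → trans
      (sym (coeff-above a u k (ℕ.≤-trans (ℕ.m≤n+m d (ℕ.pred m)) le)))
      (v (suc k) (ℕ.≤-trans (ℕ.+-monoˡ-≤ d (≤-suc-pred m)) (s≤s le)))

  *ₚ-vanish⁺ : ∀ u m → (∀ k → m < k → coeff u k ≡ 0ℤ) →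
               ∀ k → m ℕ.+ d < k → coeff (u *ₚ g) k ≡ 0ℤ
  *ₚ-vanish⁺ []      m       v k       _         = refl
  *ₚ-vanish⁺ (a ∷ u) zero    v (suc k) (s≤s d≤k) =
    trans (coeff-above a u k d≤k) (at (*ₚ-cong (tail≋[] v ℕ.≤-refl) (≋-refl {g})) k)
  *ₚ-vanish⁺ (a ∷ u) (suc m) v (suc k) (s≤s le)  =
    trans (coeff-above a u k (ℕ.≤-trans (ℕ.m≤n+m d (suc m)) le))
          (*ₚ-vanish⁺ u m (λ k m<k → v (suc k) (s≤s m<k)) k le)

  *ₚ-leading : ∀ u m → (∀ k → m < k → coeff u k ≡ 0ℤ) → coeff (u *ₚ g) (m ℕ.+ d) ≡ coeff u m
  *ₚ-leading []      m       v = refl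
  *ₚ-leading (a ∷ u) zero    v = coeff-const a (tail≋[] v ℕ.≤-refl)
  *ₚ-leading (a ∷ u) (suc m) v = trans (coeff-above a u (m ℕ.+ d) (ℕ.m≤n+m d m))
    (*ₚ-leading u m (λ k m<k → v (suc k) (s≤s m<k)))

Monic-* : ∀ {f g} → Monic f → Monic g → Monic (f *ₚ g)
Monic-* {f} (m , l , v) (d , lead) =
  m ℕ.+ d , trans (*ₚ-leading lead f m v) l , *ₚ-vanish⁺ lead f m v

-- This makes a newly identified Φ_n monic, so that it can serve as a divisor at multiples of n.
Monic-*⁻ : ∀ {h g} → Monic g → Monic (h *ₚ g) → Monic h
Monic-*⁻ {h} {g} (d , lead) (D , l , v) with ℕ.≤-<-connex d D
... | inj₁ d≤D = m , trans (sym (*ₚ-leading lead h m above)) (trans (cong (coeff (h *ₚ g)) m+d≡D) l) , above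
  where
  m = D ℕ.∸ d
  m+d≡D = ℕ.m∸n+n≡m d≤D
  above : ∀ k → m < k → coeff h k ≡ 0ℤ
  above = *ₚ-vanish⁻ lead h (suc m) λ k le → v k (subst (_< k) m+d≡D le)
... | inj₂ D<d = contradiction (trans (sym l) (at (*ₚ-cong h≋[] (≋-refl {g})) D)) λ ()
  where
  h≋[] : h ≋ []
  h≋[] = ⟨ (λ k → *ₚ-vanish⁻ lead h 0 (λ k d≤k → v k (ℕ.<-≤-trans D<d d≤k)) k z≤n) ⟩

-ₚ≋[]⇒≋ : ∀ {f g} → f -ₚ g ≋ [] → f ≋ g
-ₚ≋[]⇒≋ {f} {g} e = begin
  f               ≈⟨ add-sub f g ⟩
  (f -ₚ g) +ₚ g   ≈⟨ +ₚ-cong e ≋-refl ⟩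
  g               ∎
  where
  open ≋-Reasoning
  add-sub : ∀ f g → f ≋ (f -ₚ g) +ₚ g
  add-sub = solve-∀ polyACR

*ₚ-cancelʳ : ∀ {g} → Monic g → ∀ {u v} → u *ₚ g ≋ v *ₚ g → u ≋ v
*ₚ-cancelʳ {g} (d , lead) {u} {v} e =
  -ₚ≋[]⇒≋ ⟨ (λ k → *ₚ-vanish⁻ lead (u -ₚ v) 0 (λ k _ → at eq k) k z≤n) ⟩
  where
  distrib : ∀ u v g → (u -ₚ v) *ₚ g ≋ u *ₚ g -ₚ v *ₚ g
  distrib = solve-∀ polyACR
  eq : (u -ₚ v) *ₚ g ≋ []
  eq = ≋-trans (distrib u v g) (≋-trans (+ₚ-cong e ≋-refl) (+ₚ-inverseʳ (v *ₚ g)))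

deg-≥ : ∀ f {k} → coeff f k ≢ 0ℤ → k ≤ deg f
deg-≥ []      f≢0 = contradiction refl f≢0
deg-≥ (a ∷ f) {zero} f≢0 = z≤n
deg-≥ (a ∷ f) {suc k} f≢0 with all? (ℤ._≟ 0ℤ) f
... | yes z = contradiction (at (All-0⇒≋[] z) k) f≢0
... | no  _ = s≤s (deg-≥ f f≢0)

deg-≤ : ∀ f {d} → (∀ k → d < k → coeff f k ≡ 0ℤ) → deg f ≤ d
deg-≤ []      v = z≤n
deg-≤ (a ∷ f) v with all? (ℤ._≟ 0ℤ) f
deg-≤ (a ∷ f) {d}     v | yes _ = z≤n
deg-≤ (a ∷ f) {zero}  v | no ¬z = contradiction (≈[]⇒All-0 f (λ k → v (suc k) z<s)) ¬z
deg-≤ (a ∷ f) {suc d} v | no ¬z = s≤s (deg-≤ f (λ k d<k → v (suc k) (s≤s d<k)))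

deg-≡ : ∀ f {d} → coeff f d ≡ 1ℤ → (∀ k → d < k → coeff f k ≡ 0ℤ) → deg f ≡ d
deg-≡ f {d} l v = ℕ.≤-antisym (deg-≤ f v) (deg-≥ f (λ e → contradiction (trans (sym l) e) λ ()))

module _ {g d} (lead : Lead g d) where

  -- Since `r` vanishes from `d` on, `a ∷ r` has no coefficient beyond place `d`, and subtracting
  -- `c ·ₚ g` clears that place.
  divMod-spec : ∀ f → f ≋ (f ÷ₚ g) *ₚ g +ₚ f %ₚ g × (∀ k → d ≤ k → coeff (f %ₚ g) k ≡ 0ℤ)
  divMod-spec []      = ≋-refl , λ _ _ → refl
  divMod-spec (a ∷ f) = ⟨ eq ⟩ , vanish
    where
    q = f ÷ₚ g
    r = f %ₚ g
    c = coeff (a ∷ r) (deg g)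
    IH = divMod-spec f

    cancel : ∀ x y z → x ℤ.+ y ≡ z ℤ.+ x ℤ.+ (y ℤ.+ -1ℤ ℤ.* z)
    cancel = solve 3 (λ x y z → x :+ y := z :+ x :+ (y :+ con -1ℤ :* z)) refl

    eq : a ∷ f ≈ (c ∷ q) *ₚ g +ₚ ((a ∷ r) -ₚ c ·ₚ g)
    eq k rewrite coeff-+ₚ ((c ∷ q) *ₚ g) ((a ∷ r) -ₚ c ·ₚ g) k
               | coeff-+ₚ (c ·ₚ g) (0ℤ ∷ q *ₚ g) k
               | coeff--ₚ (a ∷ r) (c ·ₚ g) k =
      trans (split k) (cancel (coeff (0ℤ ∷ q *ₚ g) k) (coeff (a ∷ r) k) (coeff (c ·ₚ g) k))
      where
      split : ∀ k → coeff (a ∷ f) k ≡ coeff (0ℤ ∷ q *ₚ g) k ℤ.+ coeff (a ∷ r) k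
      split zero    = sym (ℤ.+-identityˡ a)
      split (suc k) = trans (at (proj₁ IH) k) (coeff-+ₚ (q *ₚ g) r k)

    c≡ : c ≡ coeff (a ∷ r) d
    c≡ = cong (coeff (a ∷ r)) (deg-≡ g (proj₁ lead) (proj₂ lead))

    vanish : ∀ k → d ≤ k → coeff ((a ∷ r) -ₚ c ·ₚ g) k ≡ 0ℤ
    vanish k d≤k rewrite coeff--ₚ (a ∷ r) (c ·ₚ g) k | coeff-·ₚ c g k with ℕ.m≤n⇒m<n∨m≡n d≤k
    ... | inj₂ refl rewrite proj₁ lead | c≡ =
      solve 1 (λ x → x :+ con -1ℤ :* (x :* con 1ℤ) := con 0ℤ) refl (coeff (a ∷ r) d)
    vanish (suc k) _ | inj₁ (s≤s d≤k) rewrite proj₂ lead (suc k) (s≤s d≤k) | proj₂ IH k d≤k =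
      solve 1 (λ x → con 0ℤ :+ con -1ℤ :* (x :* con 0ℤ) := con 0ℤ) refl c

  -- The difference (h - q) g equals the remainder, a multiple of `g` of degree below `d`, hence
  -- zero.
  ÷ₚ-exact : ∀ {f h} → f ≋ h *ₚ g → f ÷ₚ g ≋ h
  ÷ₚ-exact {f} {h} e = ≋-sym (-ₚ≋[]⇒≋ ⟨ (λ k → *ₚ-vanish⁻ lead (h -ₚ q) 0
      (λ k d≤k → trans (at eq k) (proj₂ (divMod-spec f) k d≤k)) k z≤n) ⟩)
    where
    q = f ÷ₚ g
    r = f %ₚ g
    distrib : ∀ h q g → (h -ₚ q) *ₚ g ≋ h *ₚ g -ₚ q *ₚ g
    distrib = solve-∀ polyACR
    cancel : ∀ x y → (x +ₚ y) -ₚ x ≋ y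
    cancel = solve-∀ polyACR
    eq : (h -ₚ q) *ₚ g ≋ r
    eq = ≋-trans (distrib h q g) (≋-trans
      (+ₚ-cong (≋-trans (≋-sym e) (proj₁ (divMod-spec f))) (≋-refl { -1ℤ ·ₚ (q *ₚ g)}))
      (cancel (q *ₚ g) r))

-- Φ_2pq

-- Listed downwards like `table`, which makes `filter-table` an equality of lists.
properDivisors : ℕ → List ℕ
properDivisors n = filter (_∣? n) (applyDownFrom suc (ℕ.pred n))

properDivisors-! : ∀ n → Unique (properDivisors n)
properDivisors-! n = Unique.filter⁺ (_∣? n)
  (Unique.applyDownFrom⁺₁ suc (ℕ.pred n) (λ j<i _ → ℕ.<⇒≢ j<i ∘ sym ∘ ℕ.suc-injective))

∈-properDivisors⁺ : ∀ {n d} .{{_ : NonZero n}} → d ∣ n → d < n → d ∈ properDivisors n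
∈-properDivisors⁺ {suc m} {zero}  d∣n _         = contradiction (∣.0∣⇒≡0 d∣n) λ ()
∈-properDivisors⁺ {suc m} {suc d} d∣n (s≤s d<m) =
  ∈.∈-filter⁺ (_∣? suc m) (∈.∈-applyDownFrom⁺ suc d<m) d∣n

∈-properDivisors⁻ : ∀ {n d} .{{_ : NonZero n}} → d ∈ properDivisors n → d ∣ n × d < n
∈-properDivisors⁻ {suc m} d∈ with ∈.∈-filter⁻ (_∣? suc m) {xs = applyDownFrom suc m} d∈
... | d∈′ , d∣n with ∈.∈-applyDownFrom⁻ suc d∈′
...   | _ , i<m , refl = d∣n , s≤s i<m

filter-graph : ∀ {p} {P : ℕ → Set p} (P? : ∀ d → Dec (P d)) (f : ℕ → Poly) ds →
               map proj₂ (filter (P? ∘ proj₁) (map (λ d → d , f d) ds)) ≡ map f (filter P? ds)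
filter-graph P? f []       = refl
filter-graph P? f (d ∷ ds) with does (P? d)
... | true  = cong (f d ∷_) (filter-graph P? f ds)
... | false = filter-graph P? f ds

table≡graph : ∀ m → table m ≡ map (λ d → d , Φ d) (applyDownFrom suc m)
table≡graph zero    = refl
table≡graph (suc m) = cong ((suc m , Φ (suc m)) ∷_) (table≡graph m)

filter-table : ∀ n m → map proj₂ (filter (λ dΦ → proj₁ dΦ ∣? n) (table m)) ≡
                       map Φ (filter (_∣? n) (applyDownFrom suc m))
filter-table n m = trans (cong (map proj₂ ∘ filter ((_∣? n) ∘ proj₁)) (table≡graph m))
                         (filter-graph (_∣? n) Φ (applyDownFrom suc m))

Φ-÷ₚ : ∀ n .{{_ : NonZero n}} → Φ n ≡ (x^ n -ₚ 1ₚ) ÷ₚ ∏ (map Φ (properDivisors n))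
Φ-÷ₚ (suc m) = cong (λ fs → (x^ (suc m) -ₚ 1ₚ) ÷ₚ ∏ fs) (filter-table (suc m) m)

∏-↭ : ∀ {fs gs} → fs ↭ gs → ∏ fs ≋ ∏ gs
∏-↭ ↭.refl          = ≋-refl
∏-↭ (↭.prep f p)    = *ₚ-congˡ f (∏-↭ p)
∏-↭ (↭.swap {fs} {gs} f g p) = ≋-trans (*ₚ-congˡ f (*ₚ-congˡ g (∏-↭ p))) (exchange f g (∏ gs))
  where
  exchange : ∀ f g h → f *ₚ (g *ₚ h) ≋ g *ₚ (f *ₚ h)
  exchange = solve-∀ polyACR
∏-↭ (↭.trans p p′)  = ≋-trans (∏-↭ p) (∏-↭ p′)

∏-Monic : ∀ {fs} → All Monic fs → Monic (∏ fs)
∏-Monic []       = 0 , refl , λ { (suc k) _ → refl }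
∏-Monic {f ∷ fs} (m ∷ ms) = Monic-* {f} {∏ fs} m (∏-Monic ms)

x^-1-Lead : ∀ n .{{_ : NonZero n}} → Lead (x^ n -ₚ 1ₚ) n
x^-1-Lead n@(suc _) = trans (coeff--ₚ (x^ n) 1ₚ n) (trans (ℤ.+-identityʳ _)
                        (trans (at (x^≋linear^ n) n) (trans (coeff-linear^ 1ℤ n) (ℤ.^-zeroˡ n)))) ,
  λ { k@(suc _) n<k → trans (coeff--ₚ (x^ n) 1ₚ k) (trans (ℤ.+-identityʳ _)
                        (trans (at (x^≋linear^ n) k) (coeff-linear^-≢ 1ℤ n (ℕ.<⇒≢ n<k ∘ sym)))) }

-- A duplicate-free list with the same members as `properDivisors n` is a permutation of it, so `ds`
-- may come in any convenient order. The product over `ds` is then the divisor in the definition of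
-- `Φ n`, and the division is exact.
Φ-unique : ∀ n .{{_ : NonZero n}} ds {h} → Unique ds → All (λ d → d ∣ n × d < n) ds →
           (∀ {d} → d ∣ n → d < n → d ∈ ds) → All (λ d → Monic (Φ d)) ds →
           h *ₚ ∏ (map Φ ds) ≋ x^ n -ₚ 1ₚ → Φ n ≋ h × Monic (Φ n)
Φ-unique n ds {h} ds! ds⊆ ds⊇ monic e = Φn≋h , Monic-resp-≋ (≋-sym Φn≋h) h-monic
  where
  P = ∏ (map Φ (properDivisors n))

  ds↭ : ds ↭ properDivisors n
  ds↭ = ∼bag⇒↭ (unique∧set⇒bag ds! (properDivisors-! n)
    (mk⇔ (λ d∈ → let d∣n , d<n = All.lookup ds⊆ d∈ in ∈-properDivisors⁺ d∣n d<n)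
         (λ d∈ → let d∣n , d<n = ∈-properDivisors⁻ d∈ in ds⊇ d∣n d<n)))

  ∏≋P : ∏ (map Φ ds) ≋ P
  ∏≋P = ∏-↭ (↭.map⁺ Φ ds↭)

  ∏-monic : ∀ {ds} → All (λ d → Monic (Φ d)) ds → Monic (∏ (map Φ ds))
  ∏-monic = ∏-Monic ∘ go
    where
    go : ∀ {ds} → All (λ d → Monic (Φ d)) ds → All Monic (map Φ ds)
    go []       = []
    go (m ∷ ms) = m ∷ go ms

  P-monic : Monic P
  P-monic = Monic-resp-≋ ∏≋P (∏-monic monic)

  e′ : x^ n -ₚ 1ₚ ≋ h *ₚ P
  e′ = ≋-sym (≋-trans (*ₚ-congˡ h (≋-sym ∏≋P)) e)

  h-monic : Monic h
  h-monic = Monic-*⁻ {h} {P} P-monic (Monic-resp-≋ e′ (n , x^-1-Lead n))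

  Φn≋h : Φ n ≋ h
  Φn≋h = subst (_≋ h) (sym (Φ-÷ₚ n)) (÷ₚ-exact (proj₂ P-monic) e′)

prime∤⇒coprime : ∀ {p d} → Prime p → p ∤ d → Coprime d p
prime∤⇒coprime pr p∤d (e∣d , e∣p) with prime⇒irreducible pr e∣p
... | inj₁ e≡1  = e≡1
... | inj₂ refl = contradiction e∣d p∤d

-- Peeling off one prime at a time enumerates the divisors of 2 p, p q and 2 p q.
∣-prime* : ∀ {p m d} → Prime p → d ∣ p ℕ.* m → d ∣ m ⊎ ∃[ e ] d ≡ p ℕ.* e × e ∣ m
∣-prime* {p} {m} {d} pr d∣pm with p ∣? d
... | no  p∤d = inj₁ (coprime-divisor (prime∤⇒coprime pr p∤d) d∣pm)
... | yes (divides e refl) = inj₂ (e , ℕ.*-comm e p ,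
  ∣.*-cancelˡ-∣ p {{prime⇒nonZero pr}} (subst (_∣ p ℕ.* m) (ℕ.*-comm e p) d∣pm))

-- Parity is recorded from here on as the sign (-1)^m, which is also the form in which it enters the
-- coefficients.
odd-power : ∀ m → 2 ∤ m → -1ℤ ℤ.^ m ≡ -1ℤ
odd-power zero          2∤m = contradiction (2 ∣.∣0) 2∤m
odd-power (suc zero)    2∤m = refl
odd-power (suc (suc m)) 2∤m = trans (sym (ℤ.*-assoc -1ℤ -1ℤ (-1ℤ ℤ.^ m)))
  (trans (ℤ.*-identityˡ _) (odd-power m (2∤m ∘ ∣.∣m∣n⇒∣m+n (∣.∣-refl {2}))))

odd>1⇒>2 : ∀ {p} → 2 ∤ p → 1 < p → 2 < p
odd>1⇒>2 2∤p 1<p = ℕ.≤∧≢⇒< 1<p λ { refl → 2∤p ∣.∣-refl }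

prime⇒>1 : ∀ {p} → Prime p → 1 < p
prime⇒>1 {p} pr = ℕ.nonTrivial⇒n>1 p {{prime⇒nonTrivial pr}}

-- y is -x: evaluating an identity at t = y in place of t = x turns Φ_p and
-- Φ_pq into Φ_2p and Φ_2pq.
x y : Poly
x = linear 1ℤ
y = linear -1ℤ

y^odd : ∀ {m} → -1ℤ ℤ.^ m ≡ -1ℤ → y ^ₚ m ≋ -1ℤ ·ₚ x ^ₚ m
y^odd {m} e = ⟨ eq ⟩
  where
  eq : y ^ₚ m ≈ -1ℤ ·ₚ x ^ₚ m
  eq k rewrite coeff-·ₚ -1ℤ (x ^ₚ m) k with k ℕ.≟ m
  ... | yes refl rewrite coeff-linear^ 1ℤ k | coeff-linear^ -1ℤ k | e | ℤ.^-zeroˡ k = refl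
  ... | no  k≢m  rewrite coeff-linear^-≢ 1ℤ m k≢m | coeff-linear^-≢ -1ℤ m k≢m = refl

Φ₁-monic : Monic (Φ 1)
Φ₁-monic = 1 , refl , λ { (suc zero) (s≤s ()) ; (suc (suc k)) _ → refl }

Φ₂≋ : Φ 2 ≋ 1ₚ -ₚ y
Φ₂≋ = ⟨ (λ { zero → refl ; (suc zero) → refl ; (suc (suc zero)) → refl ; (suc (suc (suc k))) → refl }) ⟩

1-y-monic : Monic (1ₚ -ₚ y)
1-y-monic = 1 , refl , λ { (suc zero) (s≤s ()) ; (suc (suc k)) _ → refl }

Φ₂-monic : Monic (Φ 2)
Φ₂-monic = Monic-resp-≋ (≋-sym Φ₂≋) 1-y-monic

*ₚ-cancel-x-1 : ∀ {u v} → (1ₚ -ₚ x) *ₚ u ≋ (1ₚ -ₚ x) *ₚ v → u ≋ v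
*ₚ-cancel-x-1 {u} {v} e = *ₚ-cancelʳ {x -ₚ 1ₚ} Φ₁-monic
  (≋-trans (flip x u) (≋-trans (·ₚ-cong -1ℤ e) (≋-sym (flip x v))))
  where
  flip : ∀ t u → u *ₚ (t -ₚ 1ₚ) ≋ [] -ₚ ((1ₚ -ₚ t) *ₚ u)
  flip = solve-∀ polyACR

*ₚ-cancel-1-y : ∀ {u v} → (1ₚ -ₚ y) *ₚ u ≋ (1ₚ -ₚ y) *ₚ v → u ≋ v
*ₚ-cancel-1-y {u} {v} e = *ₚ-cancelʳ 1-y-monic
  (≋-trans (*ₚ-comm u (1ₚ -ₚ y)) (≋-trans e (*ₚ-comm (1ₚ -ₚ y) v)))

Φ₁-geo : ∀ m → Φ 1 *ₚ geo m x ≋ x ^ₚ m -ₚ 1ₚ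
Φ₁-geo m = ≋-trans (flip x (geo m x)) (≋-trans (·ₚ-cong -1ℤ (geo-sum m x)) (flip′ (x ^ₚ m)))
  where
  flip : ∀ t u → (t -ₚ 1ₚ) *ₚ u ≋ [] -ₚ ((1ₚ -ₚ t) *ₚ u)
  flip = solve-∀ polyACR
  flip′ : ∀ t → [] -ₚ (1ₚ -ₚ t) ≋ t -ₚ 1ₚ
  flip′ = solve-∀ polyACR

proper : ∀ {d e n} → 0 < d → 1 < e → d ℕ.* e ≡ n → d ∣ n × d < n
proper {suc d} {e} _ 1<e refl = ∣.m∣m*n e , ℕ.m<m*n (suc d) e 1<e

x^-1≋ : ∀ n → x ^ₚ n -ₚ 1ₚ ≋ x^ n -ₚ 1ₚ
x^-1≋ n = +ₚ-cong (≋-sym (x^≋linear^ n)) ≋-refl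

x^-doubled : ∀ m → -1ℤ ℤ.^ m ≡ -1ℤ → (x ^ₚ m -ₚ 1ₚ) *ₚ (1ₚ -ₚ y ^ₚ m) ≋ x ^ₚ (2 ℕ.* m) -ₚ 1ₚ
x^-doubled m odd = begin
  (x ^ₚ m -ₚ 1ₚ) *ₚ (1ₚ -ₚ y ^ₚ m)
    ≈⟨ *ₚ-congˡ (x ^ₚ m -ₚ 1ₚ) (+ₚ-cong (≋-refl {1ₚ}) (·ₚ-cong -1ℤ (y^odd {m} odd))) ⟩
  (x ^ₚ m -ₚ 1ₚ) *ₚ (1ₚ -ₚ -1ℤ ·ₚ x ^ₚ m)
    ≈⟨ difference-of-squares (x ^ₚ m) ⟩
  x ^ₚ m *ₚ x ^ₚ m -ₚ 1ₚ
    ≈⟨ +ₚ-cong (≋-sym (^-homo-* x m m)) (≋-refl { -1ℤ ·ₚ 1ₚ}) ⟩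
  x ^ₚ (m ℕ.+ m) -ₚ 1ₚ
    ≡⟨ cong (λ k → x ^ₚ (m ℕ.+ k) -ₚ 1ₚ) (ℕ.+-identityʳ m) ⟨
  x ^ₚ (2 ℕ.* m) -ₚ 1ₚ ∎
  where
  open ≋-Reasoning
  difference-of-squares : ∀ t → (t -ₚ 1ₚ) *ₚ (1ₚ -ₚ ([] -ₚ t)) ≋ t *ₚ t -ₚ 1ₚ
  difference-of-squares = solve-∀ polyACR

module _ {p} (p-prime : Prime p) where
  private
    instance
      _ = prime⇒nonZero p-prime

    1<p = prime⇒>1 p-prime

  Φ-prime : Φ p ≋ geo p x × Monic (Φ p)
  Φ-prime = Φ-unique p (1 ∷ []) ([] ∷ []) (proper z<s 1<p (ℕ.*-identityˡ p) ∷ []) divisors (Φ₁-monic ∷ [])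
    (begin
      geo p x *ₚ (Φ 1 *ₚ 1ₚ) ≈⟨ regroup (geo p x) (Φ 1) ⟩
      Φ 1 *ₚ geo p x         ≈⟨ Φ₁-geo p ⟩
      x ^ₚ p -ₚ 1ₚ           ≈⟨ x^-1≋ p ⟩
      x^ p -ₚ 1ₚ             ∎)
    where
    open ≋-Reasoning
    regroup : ∀ g u → g *ₚ (u *ₚ 1ₚ) ≋ u *ₚ g
    regroup = solve-∀ polyACR
    divisors : ∀ {d} → d ∣ p → d < p → d ∈ 1 ∷ []
    divisors d∣p d<p with prime⇒irreducible p-prime d∣p
    ... | inj₁ d≡1  = here d≡1
    ... | inj₂ refl = contradiction d<p (ℕ.<-irrefl refl)

  module _ (2∤p : 2 ∤ p) where
    private
      2<p = odd>1⇒>2 2∤p 1<p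
      instance
        _ = ℕ.>-nonZero (ℕ.*-mono-< (z<s {1}) (ℕ.<-trans z<s 1<p))

    Φ-2prime : Φ (2 ℕ.* p) ≋ geo p y × Monic (Φ (2 ℕ.* p))
    Φ-2prime = Φ-unique (2 ℕ.* p) (1 ∷ 2 ∷ p ∷ [])
      (AllPairs.map ℕ.<⇒≢ (Linked⇒AllPairs ℕ.<-trans (s<s z<s ∷ 2<p ∷ [-])))
      (proper z<s (ℕ.<-≤-trans 1<p (ℕ.m≤n*m p 2)) (ℕ.*-identityˡ _) ∷
       proper z<s 1<p refl ∷
       proper (ℕ.<-trans z<s 1<p) (s<s z<s) (ℕ.*-comm p 2) ∷ [])
      divisors
      (Φ₁-monic ∷ Φ₂-monic ∷ proj₂ Φ-prime ∷ [])
      (begin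
        geo p y *ₚ (Φ 1 *ₚ (Φ 2 *ₚ (Φ p *ₚ 1ₚ)))
          ≈⟨ *ₚ-congˡ (geo p y) (*ₚ-congˡ (Φ 1) (*ₚ-cong Φ₂≋ (*ₚ-cong (proj₁ Φ-prime) (≋-refl {1ₚ})))) ⟩
        geo p y *ₚ (Φ 1 *ₚ ((1ₚ -ₚ y) *ₚ (geo p x *ₚ 1ₚ)))
          ≈⟨ regroup (geo p y) (Φ 1) (1ₚ -ₚ y) (geo p x) ⟩
        (Φ 1 *ₚ geo p x) *ₚ ((1ₚ -ₚ y) *ₚ geo p y)
          ≈⟨ *ₚ-cong (Φ₁-geo p) (geo-sum p y) ⟩
        (x ^ₚ p -ₚ 1ₚ) *ₚ (1ₚ -ₚ y ^ₚ p)
          ≈⟨ x^-doubled p (odd-power p 2∤p) ⟩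
        x ^ₚ (2 ℕ.* p) -ₚ 1ₚ
          ≈⟨ x^-1≋ (2 ℕ.* p) ⟩
        x^ (2 ℕ.* p) -ₚ 1ₚ ∎)
      where
      open ≋-Reasoning
      regroup : ∀ g u v w → g *ₚ (u *ₚ (v *ₚ (w *ₚ 1ₚ))) ≋ (u *ₚ w) *ₚ (v *ₚ g)
      regroup = solve-∀ polyACR
      divisors : ∀ {d} → d ∣ 2 ℕ.* p → d < 2 ℕ.* p → d ∈ 1 ∷ 2 ∷ p ∷ []
      divisors d∣2p d<2p with ∣-prime* prime[2] d∣2p
      ... | inj₁ d∣p with prime⇒irreducible p-prime d∣p
      ...   | inj₁ d≡1 = here d≡1
      ...   | inj₂ d≡p = there (there (here d≡p))
      divisors d∣2p d<2p | inj₂ (e , refl , e∣p) with prime⇒irreducible p-prime e∣p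
      ...   | inj₁ refl = there (here refl)
      ...   | inj₂ refl = contradiction d<2p (ℕ.<-irrefl refl)

module Cyclotomic {p q : ℕ} (p-prime : Prime p) (q-prime : Prime q)
  (2∤p : 2 ∤ p) (2∤q : 2 ∤ q) (p<q : p < q)
  (I : Inverses p q) where

  open Lam-Leung I public

  private
    instance
      _ = prime⇒nonZero p-prime
      _ = prime⇒nonZero q-prime
      _ = ℕ.m*n≢0 p q
      _ = ℕ.m*n≢0 2 p
      _ = ℕ.m*n≢0 (2 ℕ.* p) q

    1<p = prime⇒>1 p-prime
    1<q = prime⇒>1 q-prime
    2<p = odd>1⇒>2 2∤p 1<p
    0<p = ℕ.<-trans z<s 1<p
    0<q = ℕ.<-trans z<s 1<q
    2q<pq = ℕ.*-monoˡ-< q 2<p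

    odd-pq : -1ℤ ℤ.^ (p ℕ.* q) ≡ -1ℤ
    odd-pq = trans (sym (ℤ.^-*-assoc -1ℤ p q)) (trans (cong (ℤ._^ q) (odd-power p 2∤p)) (odd-power q 2∤q))

    n = 2 ℕ.* p ℕ.* q

    n≡2pq : n ≡ 2 ℕ.* (p ℕ.* q)
    n≡2pq = ℕ.*-assoc 2 p q

  Φ-pq : Φ (p ℕ.* q) ≋ Ψ x × Monic (Φ (p ℕ.* q))
  Φ-pq = Φ-unique (p ℕ.* q) (1 ∷ p ∷ q ∷ [])
    (AllPairs.map ℕ.<⇒≢ (Linked⇒AllPairs ℕ.<-trans (1<p ∷ p<q ∷ [-])))
    (proper z<s (ℕ.<-≤-trans 1<p (ℕ.m≤m*n p q)) (ℕ.*-identityˡ _) ∷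
     proper 0<p 1<q refl ∷
     proper 0<q 1<p (ℕ.*-comm q p) ∷ [])
    divisors
    (Φ₁-monic ∷ proj₂ (Φ-prime p-prime) ∷ proj₂ (Φ-prime q-prime) ∷ [])
    (begin
      Ψ x *ₚ (Φ 1 *ₚ (Φ p *ₚ (Φ q *ₚ 1ₚ)))
        ≈⟨ *ₚ-congˡ (Ψ x) (*ₚ-congˡ (Φ 1) (*ₚ-cong (proj₁ (Φ-prime p-prime))
             (*ₚ-cong (proj₁ (Φ-prime q-prime)) (≋-refl {1ₚ})))) ⟩
      Ψ x *ₚ (Φ 1 *ₚ (geo p x *ₚ (geo q x *ₚ 1ₚ)))
        ≈⟨ regroup (Ψ x) x (geo p x) (geo q x) ⟩
      -1ℤ ·ₚ ((1ₚ -ₚ x) *ₚ geo p x *ₚ geo q x *ₚ Ψ x)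
        ≈⟨ ·ₚ-cong -1ℤ (*ₚ-cancel-x-1 (Ψ-product x)) ⟩
      -1ℤ ·ₚ (1ₚ -ₚ x ^ₚ (p ℕ.* q))
        ≈⟨ flip (x ^ₚ (p ℕ.* q)) ⟩
      x ^ₚ (p ℕ.* q) -ₚ 1ₚ
        ≈⟨ x^-1≋ (p ℕ.* q) ⟩
      x^ (p ℕ.* q) -ₚ 1ₚ ∎)
    where
    open ≋-Reasoning
    regroup : ∀ ψ t u v → ψ *ₚ ((t -ₚ 1ₚ) *ₚ (u *ₚ (v *ₚ 1ₚ))) ≋ [] -ₚ ((1ₚ -ₚ t) *ₚ u *ₚ v *ₚ ψ)
    regroup = solve-∀ polyACR
    flip : ∀ t → [] -ₚ (1ₚ -ₚ t) ≋ t -ₚ 1ₚ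
    flip = solve-∀ polyACR
    divisors : ∀ {d} → d ∣ p ℕ.* q → d < p ℕ.* q → d ∈ 1 ∷ p ∷ q ∷ []
    divisors d∣pq d<pq with ∣-prime* p-prime d∣pq
    ... | inj₁ d∣q with prime⇒irreducible q-prime d∣q
    ...   | inj₁ d≡1 = here d≡1
    ...   | inj₂ d≡q = there (there (here d≡q))
    divisors d∣pq d<pq | inj₂ (e , refl , e∣q) with prime⇒irreducible q-prime e∣q
    ...   | inj₁ refl = there (here (ℕ.*-identityʳ p))
    ...   | inj₂ refl = contradiction d<pq (ℕ.<-irrefl refl)

  -- The factors fall into two groups. Those in x multiply to x^(pq) - 1 and those in y, with `Φ 2`
  -- as 1 - y, to 1 - y^(pq), both by `Ψ-product`; `x^-doubled` joins the two.
  Φ-2pq : Φ n ≋ Ψ y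
  -- `2 * p` stands apart because its order relative to `q` is open; parity separates these two. The
  -- other divisors form the chain 1 < 2 < p < q < 2 q < p q.
  Φ-2pq = proj₁ $ Φ-unique n (2 ℕ.* p ∷ 1 ∷ 2 ∷ p ∷ q ∷ 2 ℕ.* q ∷ p ℕ.* q ∷ [])
    ((ℕ.>⇒≢ (ℕ.<-trans (s<s z<s) 2<2p) ∷ ℕ.>⇒≢ 2<2p ∷ ℕ.>⇒≢ (m<2m 0<p) ∷
      (λ 2p≡q → 2∤q (subst (2 ∣_) 2p≡q (∣.m∣m*n p))) ∷
      ℕ.<⇒≢ 2p<2q ∷ ℕ.<⇒≢ (ℕ.<-trans 2p<2q 2q<pq) ∷ [])
     ∷ AllPairs.map ℕ.<⇒≢ (Linked⇒AllPairs ℕ.<-trans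
         (s<s z<s ∷ 2<p ∷ p<q ∷ m<2m 0<q ∷ 2q<pq ∷ [-])))
    (proper (ℕ.<-trans z<s 2<2p) 1<q refl ∷
     proper z<s (ℕ.<-≤-trans (ℕ.<-trans (s<s z<s) 2<2p) (ℕ.m≤m*n (2 ℕ.* p) q)) (ℕ.*-identityˡ _) ∷
     proper z<s (ℕ.<-≤-trans 1<p (ℕ.m≤m*n p q)) (sym n≡2pq) ∷
     proper 0<p (ℕ.<-trans 1<q (m<2m 0<q)) (p·2q p q) ∷
     proper 0<q (ℕ.<-trans (s<s z<s) 2<2p) (ℕ.*-comm q (2 ℕ.* p)) ∷
     proper (ℕ.<-trans 0<q (m<2m 0<q)) 1<p (2q·p p q) ∷
     proper (ℕ.<-trans (ℕ.<-trans 0<q (m<2m 0<q)) 2q<pq) (s<s z<s)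
       (trans (ℕ.*-comm (p ℕ.* q) 2) (sym n≡2pq)) ∷ [])
    divisors
    (proj₂ (Φ-2prime p-prime 2∤p) ∷ Φ₁-monic ∷ Φ₂-monic ∷ proj₂ (Φ-prime p-prime) ∷
     proj₂ (Φ-prime q-prime) ∷ proj₂ (Φ-2prime q-prime 2∤q) ∷ proj₂ Φ-pq ∷ [])
    (begin
      Ψ y *ₚ (Φ (2 ℕ.* p) *ₚ (Φ 1 *ₚ (Φ 2 *ₚ (Φ p *ₚ (Φ q *ₚ (Φ (2 ℕ.* q) *ₚ (Φ (p ℕ.* q) *ₚ 1ₚ)))))))
        ≈⟨ *ₚ-congˡ (Ψ y) (*ₚ-cong (proj₁ (Φ-2prime p-prime 2∤p)) (*ₚ-congˡ (Φ 1) (*ₚ-cong Φ₂≋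
             (*ₚ-cong (proj₁ (Φ-prime p-prime)) (*ₚ-cong (proj₁ (Φ-prime q-prime))
             (*ₚ-cong (proj₁ (Φ-2prime q-prime 2∤q)) (*ₚ-cong (proj₁ Φ-pq) (≋-refl {1ₚ})))))))) ⟩
      Ψ y *ₚ (geo p y *ₚ (Φ 1 *ₚ ((1ₚ -ₚ y) *ₚ (geo p x *ₚ (geo q x *ₚ (geo q y *ₚ (Ψ x *ₚ 1ₚ)))))))
        ≈⟨ regroup (Ψ y) (geo p y) x (1ₚ -ₚ y) (geo p x) (geo q x) (geo q y) (Ψ x) ⟩
      (-1ℤ ·ₚ ((1ₚ -ₚ x) *ₚ geo p x *ₚ geo q x *ₚ Ψ x)) *ₚ ((1ₚ -ₚ y) *ₚ geo p y *ₚ geo q y *ₚ Ψ y)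
        ≈⟨ *ₚ-cong (·ₚ-cong -1ℤ (*ₚ-cancel-x-1 (Ψ-product x))) (*ₚ-cancel-1-y (Ψ-product y)) ⟩
      (-1ℤ ·ₚ (1ₚ -ₚ x ^ₚ (p ℕ.* q))) *ₚ (1ₚ -ₚ y ^ₚ (p ℕ.* q))
        ≈⟨ *ₚ-cong (flip (x ^ₚ (p ℕ.* q))) ≋-refl ⟩
      (x ^ₚ (p ℕ.* q) -ₚ 1ₚ) *ₚ (1ₚ -ₚ y ^ₚ (p ℕ.* q))
        ≈⟨ x^-doubled (p ℕ.* q) odd-pq ⟩
      x ^ₚ (2 ℕ.* (p ℕ.* q)) -ₚ 1ₚ
        ≡⟨ cong (λ k → x ^ₚ k -ₚ 1ₚ) n≡2pq ⟨
      x ^ₚ n -ₚ 1ₚ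
        ≈⟨ x^-1≋ n ⟩
      x^ n -ₚ 1ₚ ∎)
    where
    open ≋-Reasoning
    m<2m : ∀ {m} → 0 < m → m < 2 ℕ.* m
    m<2m {m} 0<m = ℕ.m<m+n m (subst (0 <_) (sym (ℕ.+-identityʳ m)) 0<m)
    2<2p = ℕ.*-monoʳ-< 2 1<p
    2p<2q = ℕ.*-monoʳ-< 2 p<q
    p·2q : ∀ p q → p ℕ.* (2 ℕ.* q) ≡ 2 ℕ.* p ℕ.* q
    p·2q = ℕSolver.solve-∀
    2q·p : ∀ p q → 2 ℕ.* q ℕ.* p ≡ 2 ℕ.* p ℕ.* q
    2q·p = ℕSolver.solve-∀
    regroup : ∀ ψ a t v b c d ψ′ →
      ψ *ₚ (a *ₚ ((t -ₚ 1ₚ) *ₚ (v *ₚ (b *ₚ (c *ₚ (d *ₚ (ψ′ *ₚ 1ₚ))))))) ≋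
      ([] -ₚ ((1ₚ -ₚ t) *ₚ b *ₚ c *ₚ ψ′)) *ₚ (v *ₚ a *ₚ d *ₚ ψ)
    regroup = solve-∀ polyACR
    flip : ∀ t → [] -ₚ (1ₚ -ₚ t) ≋ t -ₚ 1ₚ
    flip = solve-∀ polyACR
    divisors : ∀ {d} → d ∣ n → d < n → d ∈ 2 ℕ.* p ∷ 1 ∷ 2 ∷ p ∷ q ∷ 2 ℕ.* q ∷ p ℕ.* q ∷ []
    divisors {d} d∣n d<n with ∣-prime* prime[2] (subst (d ∣_) n≡2pq d∣n)
    divisors d∣n d<n | inj₁ d∣pq with ∣-prime* p-prime d∣pq
    divisors d∣n d<n | inj₁ d∣pq | inj₁ d∣q with prime⇒irreducible q-prime d∣q
    ... | inj₁ d≡1 = there (here d≡1)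
    ... | inj₂ d≡q = there (there (there (there (here d≡q))))
    divisors d∣n d<n | inj₁ d∣pq | inj₂ (e , refl , e∣q) with prime⇒irreducible q-prime e∣q
    ... | inj₁ refl = there (there (there (here (ℕ.*-identityʳ p))))
    ... | inj₂ refl = there (there (there (there (there (there (here refl))))))
    divisors d∣n d<n | inj₂ (e , refl , e∣pq) with ∣-prime* p-prime e∣pq
    divisors d∣n d<n | inj₂ (e , refl , e∣pq) | inj₁ e∣q with prime⇒irreducible q-prime e∣q
    ... | inj₁ refl = there (there (here refl))
    ... | inj₂ refl = there (there (there (there (there (here refl)))))
    divisors d∣n d<n | inj₂ (e , refl , e∣pq) | inj₂ (f , refl , f∣q) with prime⇒irreducible q-prime f∣q
    ... | inj₁ refl = here (cong (2 ℕ.*_) (ℕ.*-identityʳ p))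
    ... | inj₂ refl = contradiction d<n (ℕ.<-irrefl (sym n≡2pq))

-- Coefficients of Φ_2pq

module _ (s : ℤ) (p : ℕ) (F : Poly) where
  private
    X = linear s ^ₚ p

    coeff-geo-suc : ∀ m k → coeff (geo (suc m) X *ₚ F) k ≡ coeff F k ℤ.+ coeff (X *ₚ (geo m X *ₚ F)) k
    coeff-geo-suc m k = trans (at (unfold X (geo m X) F) k) (coeff-+ₚ F (X *ₚ (geo m X *ₚ F)) k)
      where
      unfold : ∀ X g f → (1ₚ +ₚ X *ₚ g) *ₚ f ≋ f +ₚ X *ₚ (g *ₚ f)
      unfold = solve-∀ polyACR

  mutual
    coeff-geo≡0 : ∀ m k → (∀ i l → i < m → k ≡ i ℕ.* p ℕ.+ l → coeff F l ≡ 0ℤ) →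
                  coeff (geo m X *ₚ F) k ≡ 0ℤ
    coeff-geo≡0 zero    k v = refl
    coeff-geo≡0 (suc m) k v = trans (coeff-geo-suc m k)
      (cong₂ ℤ._+_ (v 0 k z<s refl) (coeff-X*geo≡0 m k λ i l i<m → v (suc i) l (s<s i<m)))

    coeff-X*geo≡0 : ∀ m k → (∀ i l → i < m → k ≡ suc i ℕ.* p ℕ.+ l → coeff F l ≡ 0ℤ) →
                    coeff (X *ₚ (geo m X *ₚ F)) k ≡ 0ℤ
    coeff-X*geo≡0 m k v with ℕ.≤-<-connex p k
    ... | inj₂ k<p = coeff-linear^-*ₚ-< s p (geo m X *ₚ F) k<p
    ... | inj₁ p≤k with ℕ.m≤n⇒∃[o]m+o≡n p≤k
    ...   | k′ , refl = trans (coeff-linear^-*ₚ s p (geo m X *ₚ F) k′)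
      (trans (cong (s ℤ.^ p ℤ.*_) (coeff-geo≡0 m k′ λ i l i<m e →
                v i l i<m (trans (cong (p ℕ.+_) e) (sym (ℕ.+-assoc p (i ℕ.* p) l)))))
             (ℤ.*-zeroʳ (s ℤ.^ p)))

  -- The coefficient at k is the sum over i′ < m of s^(p i′) times the coefficient of `F` at k - i′
  -- p. The hypothesis kills every summand but the one at `i`.
  coeff-geo : ∀ m i l → i < m →
    (∀ i′ l′ → i′ < m → i′ ≢ i → i ℕ.* p ℕ.+ l ≡ i′ ℕ.* p ℕ.+ l′ → coeff F l′ ≡ 0ℤ) →
    coeff (geo m X *ₚ F) (i ℕ.* p ℕ.+ l) ≡ (s ℤ.^ p) ℤ.^ i ℤ.* coeff F l
  coeff-geo (suc m) zero l _ v = begin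
    coeff (geo (suc m) X *ₚ F) l
      ≡⟨ coeff-geo-suc m l ⟩
    coeff F l ℤ.+ coeff (X *ₚ (geo m X *ₚ F)) l
      ≡⟨ cong (λ z → coeff F l ℤ.+ z) (coeff-X*geo≡0 m l λ i l′ i<m → v (suc i) l′ (s<s i<m) λ ()) ⟩
    coeff F l ℤ.+ 0ℤ
      ≡⟨ trans (ℤ.+-identityʳ _) (sym (ℤ.*-identityˡ _)) ⟩
    1ℤ ℤ.* coeff F l ∎
    where open ≡-Reasoning
  coeff-geo (suc m) (suc i) l (s<s i<m) v = begin
    coeff (geo (suc m) X *ₚ F) (suc i ℕ.* p ℕ.+ l)
      ≡⟨ coeff-geo-suc m (suc i ℕ.* p ℕ.+ l) ⟩
    coeff F (suc i ℕ.* p ℕ.+ l) ℤ.+ coeff (X *ₚ (geo m X *ₚ F)) (suc i ℕ.* p ℕ.+ l)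
      ≡⟨ cong₂ ℤ._+_ (v 0 (suc i ℕ.* p ℕ.+ l) z<s (λ ()) refl)
           (cong (coeff (X *ₚ (geo m X *ₚ F))) (ℕ.+-assoc p (i ℕ.* p) l)) ⟩
    0ℤ ℤ.+ coeff (X *ₚ (geo m X *ₚ F)) (p ℕ.+ (i ℕ.* p ℕ.+ l))
      ≡⟨ trans (ℤ.+-identityˡ _) (coeff-linear^-*ₚ s p (geo m X *ₚ F) (i ℕ.* p ℕ.+ l)) ⟩
    s ℤ.^ p ℤ.* coeff (geo m X *ₚ F) (i ℕ.* p ℕ.+ l)
      ≡⟨ cong (s ℤ.^ p ℤ.*_) (coeff-geo m i l i<m λ i′ l′ i′<m i′≢i e →
           v (suc i′) l′ (s<s i′<m) (i′≢i ∘ ℕ.suc-injective)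
             (trans (ℕ.+-assoc p (i ℕ.* p) l) (trans (cong (p ℕ.+_) e) (sym (ℕ.+-assoc p (i′ ℕ.* p) l′))))) ⟩
    s ℤ.^ p ℤ.* ((s ℤ.^ p) ℤ.^ i ℤ.* coeff F l)
      ≡⟨ ℤ.*-assoc (s ℤ.^ p) _ _ ⟨
    (s ℤ.^ p) ℤ.^ suc i ℤ.* coeff F l ∎
    where open ≡-Reasoning

module _ (s : ℤ) (q : ℕ) where
  private
    Y = linear s ^ₚ q

    *1ₚ : ∀ f → f ≋ f *ₚ 1ₚ
    *1ₚ f = ≋-sym (≋-trans (*ₚ-comm f 1ₚ) (*ₚ-identityˡ f))

  coeff-geo₁≡0 : ∀ m k → (∀ j → j < m → k ≢ j ℕ.* q) → coeff (geo m Y) k ≡ 0ℤ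
  coeff-geo₁≡0 m k v = trans (at (*1ₚ (geo m Y)) k) (coeff-geo≡0 s q 1ₚ m k λ where
    j zero    j<m e → contradiction (trans e (ℕ.+-identityʳ _)) (v j j<m)
    j (suc l) j<m e → refl)

  coeff-geo₁ : .{{_ : NonZero q}} → ∀ m j → j < m → coeff (geo m Y) (j ℕ.* q) ≡ (s ℤ.^ q) ℤ.^ j
  coeff-geo₁ m j j<m = begin
    coeff (geo m Y) (j ℕ.* q)                ≡⟨ at (*1ₚ (geo m Y)) (j ℕ.* q) ⟩
    coeff (geo m Y *ₚ 1ₚ) (j ℕ.* q)          ≡⟨ cong (coeff (geo m Y *ₚ 1ₚ)) (ℕ.+-identityʳ (j ℕ.* q)) ⟨
    coeff (geo m Y *ₚ 1ₚ) (j ℕ.* q ℕ.+ 0)    ≡⟨ coeff-geo s q 1ₚ m j 0 j<m other ⟩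
    (s ℤ.^ q) ℤ.^ j ℤ.* 1ℤ                   ≡⟨ ℤ.*-identityʳ _ ⟩
    (s ℤ.^ q) ℤ.^ j                          ∎
    where
    open ≡-Reasoning
    other : ∀ j′ l → j′ < m → j′ ≢ j → j ℕ.* q ℕ.+ 0 ≡ j′ ℕ.* q ℕ.+ l → coeff 1ₚ l ≡ 0ℤ
    other j′ zero    _ j′≢j e = contradiction
      (sym (ℕ.*-cancelʳ-≡ j j′ q (ℕ.+-cancelʳ-≡ 0 (j ℕ.* q) (j′ ℕ.* q) e))) j′≢j
    other j′ (suc l) _ _    _ = refl

module _ (s : ℤ) (p q : ℕ) .{{_ : NonZero q}} (a b : ℕ) where
  private
    G = geo a (linear s ^ₚ p) *ₚ geo b (linear s ^ₚ q)

  coeff-geo₂≡0 : ∀ k → (∀ i j → i < a → j < b → k ≢ i ℕ.* p ℕ.+ j ℕ.* q) → coeff G k ≡ 0ℤ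
  coeff-geo₂≡0 k v = coeff-geo≡0 s p (geo b (linear s ^ₚ q)) a k λ i l i<a e →
    coeff-geo₁≡0 s q b l λ { j j<b refl → v i j i<a j<b e }

  coeff-geo₂ : ∀ i j → i < a → j < b →
    (∀ i′ j′ → i′ < a → i ℕ.* p ℕ.+ j ℕ.* q ≡ i′ ℕ.* p ℕ.+ j′ ℕ.* q → i ≡ i′) →
    coeff G (i ℕ.* p ℕ.+ j ℕ.* q) ≡ s ℤ.^ (i ℕ.* p ℕ.+ j ℕ.* q)
  coeff-geo₂ i j i<a j<b inj = begin
    coeff G (i ℕ.* p ℕ.+ j ℕ.* q)
      ≡⟨ coeff-geo s p (geo b (linear s ^ₚ q)) a i (j ℕ.* q) i<a (λ i′ l i′<a i′≢i e →
           coeff-geo₁≡0 s q b l λ { j′ _ refl → i′≢i (sym (inj i′ j′ i′<a e)) }) ⟩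
    (s ℤ.^ p) ℤ.^ i ℤ.* coeff (geo b (linear s ^ₚ q)) (j ℕ.* q)
      ≡⟨ cong ((s ℤ.^ p) ℤ.^ i ℤ.*_) (coeff-geo₁ s q b j j<b) ⟩
    (s ℤ.^ p) ℤ.^ i ℤ.* (s ℤ.^ q) ℤ.^ j
      ≡⟨ cong₂ ℤ._*_ (power p i) (power q j) ⟩
    s ℤ.^ (i ℕ.* p) ℤ.* s ℤ.^ (j ℕ.* q)
      ≡⟨ ℤ.^-distribˡ-+-* s (i ℕ.* p) (j ℕ.* q) ⟨
    s ℤ.^ (i ℕ.* p ℕ.+ j ℕ.* q) ∎
    where
    open ≡-Reasoning
    power : ∀ m i → (s ℤ.^ m) ℤ.^ i ≡ s ℤ.^ (i ℕ.* m)
    power m i = trans (ℤ.^-*-assoc s m i) (cong (s ℤ.^_) (ℕ.*-comm m i))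

-- `q` divides (a′ - a) p, hence a′ - a, which is less than `q`.
coprime⇒injective-≤ : ∀ {p q} → Coprime q p → ∀ a b a′ b′ → a ≤ a′ → a′ < q →
                      a ℕ.* p ℕ.+ b ℕ.* q ≡ a′ ℕ.* p ℕ.+ b′ ℕ.* q → a ≡ a′
coprime⇒injective-≤ {p} {q} cop a b a′ b′ a≤a′ a′<q e with ℕ.m≤n⇒∃[o]m+o≡n a≤a′
... | zero      , refl = sym (ℕ.+-identityʳ a)
... | d@(suc _) , refl = contradiction (∣.∣⇒≤ q∣d) (ℕ.<⇒≱ (ℕ.≤-<-trans (ℕ.m≤n+m d a) a′<q))
  where
  bq≡ : b ℕ.* q ≡ d ℕ.* p ℕ.+ b′ ℕ.* q
  bq≡ = ℕ.+-cancelˡ-≡ (a ℕ.* p) _ _ (trans e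
    (trans (cong (ℕ._+ b′ ℕ.* q) (ℕ.*-distribʳ-+ p a d)) (ℕ.+-assoc (a ℕ.* p) _ _)))
  q∣d : q ∣ d
  q∣d = coprime-divisor cop (subst (q ∣_) (ℕ.*-comm d p)
    (∣.∣m+n∣m⇒∣n (subst (q ∣_) (trans bq≡ (ℕ.+-comm (d ℕ.* p) _)) (∣.n∣m*n b)) (∣.n∣m*n b′)))

coprime⇒injective : ∀ {p q} → Coprime q p → ∀ a b a′ b′ → a < q → a′ < q →
                    a ℕ.* p ℕ.+ b ℕ.* q ≡ a′ ℕ.* p ℕ.+ b′ ℕ.* q → a ≡ a′
coprime⇒injective cop a b a′ b′ a<q a′<q e with ℕ.≤-total a a′
... | inj₁ a≤a′ = coprime⇒injective-≤ cop a b a′ b′ a≤a′ a′<q e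
... | inj₂ a′≤a = sym (coprime⇒injective-≤ cop a′ b′ a b a′≤a a<q (sym e))

coeff-1-y^-< : ∀ m F {k} → k < m → coeff ((1ₚ -ₚ y ^ₚ m) *ₚ F) k ≡ coeff F k
coeff-1-y^-< m F {k} k<m = begin
  coeff ((1ₚ -ₚ y ^ₚ m) *ₚ F) k                    ≡⟨ at (distrib (y ^ₚ m) F) k ⟩
  coeff (F -ₚ y ^ₚ m *ₚ F) k                       ≡⟨ coeff--ₚ F (y ^ₚ m *ₚ F) k ⟩
  coeff F k ℤ.+ -1ℤ ℤ.* coeff (y ^ₚ m *ₚ F) k      ≡⟨ cong (λ z → coeff F k ℤ.+ -1ℤ ℤ.* z) (coeff-linear^-*ₚ-< -1ℤ m F k<m) ⟩
  coeff F k ℤ.+ 0ℤ                                 ≡⟨ ℤ.+-identityʳ _ ⟩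
  coeff F k                                        ∎
  where
  open ≡-Reasoning
  distrib : ∀ Y F → (1ₚ -ₚ Y) *ₚ F ≋ F -ₚ Y *ₚ F
  distrib = solve-∀ polyACR

coeff-1-y^ : ∀ m F l → -1ℤ ℤ.^ m ≡ -1ℤ → coeff ((1ₚ -ₚ y ^ₚ m) *ₚ F) (m ℕ.+ l) ≡ coeff F (m ℕ.+ l) ℤ.+ coeff F l
coeff-1-y^ m F l odd = begin
  coeff ((1ₚ -ₚ y ^ₚ m) *ₚ F) (m ℕ.+ l)
    ≡⟨ at (distrib (y ^ₚ m) F) (m ℕ.+ l) ⟩
  coeff (F -ₚ y ^ₚ m *ₚ F) (m ℕ.+ l)
    ≡⟨ coeff--ₚ F (y ^ₚ m *ₚ F) (m ℕ.+ l) ⟩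
  coeff F (m ℕ.+ l) ℤ.+ -1ℤ ℤ.* coeff (y ^ₚ m *ₚ F) (m ℕ.+ l)
    ≡⟨ cong (λ z → coeff F (m ℕ.+ l) ℤ.+ -1ℤ ℤ.* z) (coeff-linear^-*ₚ -1ℤ m F l) ⟩
  coeff F (m ℕ.+ l) ℤ.+ -1ℤ ℤ.* (-1ℤ ℤ.^ m ℤ.* coeff F l)
    ≡⟨ cong (λ z → coeff F (m ℕ.+ l) ℤ.+ -1ℤ ℤ.* (z ℤ.* coeff F l)) odd ⟩
  coeff F (m ℕ.+ l) ℤ.+ -1ℤ ℤ.* (-1ℤ ℤ.* coeff F l)
    ≡⟨ solve 2 (λ a b → a :+ con -1ℤ :* (con -1ℤ :* b) := a :+ b) refl (coeff F (m ℕ.+ l)) (coeff F l) ⟩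
  coeff F (m ℕ.+ l) ℤ.+ coeff F l ∎
  where
  open ≡-Reasoning
  distrib : ∀ Y F → (1ₚ -ₚ Y) *ₚ F ≋ F -ₚ Y *ₚ F
  distrib = solve-∀ polyACR

1-y^-Lead : ∀ m → 0 < m → -1ℤ ℤ.^ m ≡ -1ℤ → Lead (1ₚ -ₚ y ^ₚ m) m
1-y^-Lead m@(suc _) _ odd =
    trans (coeff--ₚ 1ₚ (y ^ₚ m) m) (cong (λ z → 0ℤ ℤ.+ -1ℤ ℤ.* z) (trans (coeff-linear^ -1ℤ m) odd))
  , λ { k@(suc _) m<k → trans (coeff--ₚ 1ₚ (y ^ₚ m) k)
          (cong (λ z → 0ℤ ℤ.+ -1ℤ ℤ.* z) (coeff-linear^-≢ -1ℤ m (ℕ.>⇒≢ m<k))) }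

-- For odd `m` the polynomial is 1 + x^m.
1-y^≥0 : ∀ m → -1ℤ ℤ.^ m ≡ -1ℤ → ∀ k → 0ℤ ℤ.≤ coeff (1ₚ -ₚ y ^ₚ m) k
1-y^≥0 m odd k rewrite coeff--ₚ 1ₚ (y ^ₚ m) k = ℤ.+-mono-≤ (one k) y^
  where
  one : ∀ k → 0ℤ ℤ.≤ coeff 1ₚ k
  one zero    = +≤+ z≤n
  one (suc k) = +≤+ z≤n
  y^ : 0ℤ ℤ.≤ -1ℤ ℤ.* coeff (y ^ₚ m) k
  y^ with k ℕ.≟ m
  ... | yes refl rewrite coeff-linear^ -1ℤ k | odd = +≤+ z≤n
  ... | no  k≢m  rewrite coeff-linear^-≢ -1ℤ m k≢m = +≤+ z≤n

module Coefficients {p q : ℕ} (p-prime : Prime p) (q-prime : Prime q)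
  (2∤p : 2 ∤ p) (2∤q : 2 ∤ q) (p<q : p < q)
  (I : Inverses p q) where

  open Inverses I
  open Cyclotomic p-prime q-prime 2∤p 2∤q p<q I

  c : ℕ → ℤ
  c = coeff (Φ (2 ℕ.* p ℕ.* q))

  private
    instance
      _ = prime⇒nonZero p-prime
      _ = prime⇒nonZero q-prime

    0<p = ℕ.<-trans z<s (prime⇒>1 p-prime)
    0<q = ℕ.<-trans z<s (prime⇒>1 q-prime)

    odd-p = odd-power p 2∤p
    odd-q = odd-power q 2∤q

    odd-pq : -1ℤ ℤ.^ (p ℕ.* q) ≡ -1ℤ
    odd-pq = trans (sym (ℤ.^-*-assoc -1ℤ p q)) (trans (cong (ℤ._^ q) odd-p) odd-q)

    c≡Ψ : ∀ k → c k ≡ coeff (Ψ y) k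
    c≡Ψ = at Φ-2pq

    cop : Coprime q p
    cop = prime∤⇒coprime p-prime λ p∣q → case prime⇒irreducible q-prime p∣q of λ where
      (inj₁ p≡1) → ℕ.<⇒≢ (prime⇒>1 p-prime) (sym p≡1)
      (inj₂ p≡q) → ℕ.<⇒≢ p<q p≡q

    α≤q : α ≤ q
    α≤q = subst (α ≤_) α+α′≡q (ℕ.m≤m+n α α′)

  -- By uniqueness of the representation the first double sum contributes (-1)^k. The second
  -- contributes nothing: if k = 1 + i′ p + j′ q with i′ < α′, adding β′ q to both sides and using 1
  -- + β′ q = α p gives i p + (j + β′) q = (α + i′) p + j′ q. Both multipliers of `p` are below `q`,
  -- so i = α + i′, against i < α.
  c-lattice : ∀ i j → i < α → j < β → c (i ℕ.* p ℕ.+ j ℕ.* q) ≡ -1ℤ ℤ.^ (i ℕ.* p ℕ.+ j ℕ.* q)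
  c-lattice i j i<α j<β = begin
    c k
      ≡⟨ c≡Ψ k ⟩
    coeff (geo α X *ₚ geo β Y -ₚ y *ₚ G′) k
      ≡⟨ coeff--ₚ (geo α X *ₚ geo β Y) (y *ₚ G′) k ⟩
    coeff (geo α X *ₚ geo β Y) k ℤ.+ -1ℤ ℤ.* coeff (y *ₚ G′) k
      ≡⟨ cong₂ (λ a b → a ℤ.+ -1ℤ ℤ.* b)
           (coeff-geo₂ -1ℤ p q α β i j i<α j<β λ i′ j′ i′<α →
             coprime⇒injective cop i j i′ j′ (ℕ.<-≤-trans i<α α≤q) (ℕ.<-≤-trans i′<α α≤q))
           (second k refl) ⟩
    -1ℤ ℤ.^ k ℤ.+ 0ℤ
      ≡⟨ ℤ.+-identityʳ _ ⟩
    -1ℤ ℤ.^ k ∎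
    where
    open ≡-Reasoning
    k = i ℕ.* p ℕ.+ j ℕ.* q
    X = y ^ₚ p
    Y = y ^ₚ q
    G′ = geo α′ X *ₚ geo β′ Y

    shift : ∀ i′ j′ → i ℕ.* p ℕ.+ j ℕ.* q ≡ suc (i′ ℕ.* p ℕ.+ j′ ℕ.* q) →
            i ℕ.* p ℕ.+ (j ℕ.+ β′) ℕ.* q ≡ (α ℕ.+ i′) ℕ.* p ℕ.+ j′ ℕ.* q
    shift i′ j′ e = begin
      i ℕ.* p ℕ.+ (j ℕ.+ β′) ℕ.* q                    ≡⟨ left i j β′ p q ⟩
      i ℕ.* p ℕ.+ j ℕ.* q ℕ.+ β′ ℕ.* q                ≡⟨ cong (ℕ._+ β′ ℕ.* q) e ⟩
      suc (i′ ℕ.* p ℕ.+ j′ ℕ.* q) ℕ.+ β′ ℕ.* q        ≡⟨ right (i′ ℕ.* p) (j′ ℕ.* q) (β′ ℕ.* q) ⟩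
      suc (β′ ℕ.* q) ℕ.+ i′ ℕ.* p ℕ.+ j′ ℕ.* q        ≡⟨ cong (λ z → z ℕ.+ i′ ℕ.* p ℕ.+ j′ ℕ.* q) αp≡1+β′q ⟨
      α ℕ.* p ℕ.+ i′ ℕ.* p ℕ.+ j′ ℕ.* q               ≡⟨ cong (ℕ._+ j′ ℕ.* q) (ℕ.*-distribʳ-+ p α i′) ⟨
      (α ℕ.+ i′) ℕ.* p ℕ.+ j′ ℕ.* q                   ∎
      where
      left : ∀ i j b p q → i ℕ.* p ℕ.+ (j ℕ.+ b) ℕ.* q ≡ i ℕ.* p ℕ.+ j ℕ.* q ℕ.+ b ℕ.* q
      left = ℕSolver.solve-∀
      right : ∀ a b c → suc (a ℕ.+ b) ℕ.+ c ≡ suc c ℕ.+ a ℕ.+ b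
      right = ℕSolver.solve-∀

    second : ∀ l → k ≡ l → coeff (y *ₚ G′) l ≡ 0ℤ
    second zero    _ = at (0∷-*ₚ (-1ℤ ∷ []) G′) 0
    second (suc l) e = trans (coeff-linear-*ₚ -1ℤ G′ l) (cong (-1ℤ ℤ.*_)
      (coeff-geo₂≡0 -1ℤ p q α′ β′ l λ { i′ j′ i′<α′ _ refl →
        ℕ.<⇒≢ (ℕ.<-≤-trans i<α (ℕ.m≤m+n α i′))
          (coprime⇒injective cop i (j ℕ.+ β′) (α ℕ.+ i′) j′ (ℕ.<-≤-trans i<α α≤q)
            (subst (α ℕ.+ i′ <_) α+α′≡q (ℕ.+-monoʳ-< α i′<α′)) (shift i′ j′ e)) }))

  private
    -- In terms of x, `E` is (1 + x) (1 + x^(pq)), `D` is (1 + x^q) Φ_2pq, and (1 + x^p) D = E.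
    D E : Poly
    D = (1ₚ -ₚ y ^ₚ q) *ₚ Ψ y
    E = (1ₚ -ₚ y) *ₚ (1ₚ -ₚ y ^ₚ (p ℕ.* q))

    D-factor : (1ₚ -ₚ y ^ₚ p) *ₚ D ≋ E
    D-factor = Ψ-factors y

    y≋y^1 : y ≋ y ^ₚ 1
    y≋y^1 = ≋-sym (≋-trans (*ₚ-comm y 1ₚ) (*ₚ-identityˡ y))

    Z = 1ₚ -ₚ y ^ₚ (p ℕ.* q)

    E≋ : E ≋ (1ₚ -ₚ y ^ₚ 1) *ₚ Z
    E≋ = *ₚ-cong {g = Z} (+ₚ-cong (≋-refl {1ₚ}) (·ₚ-cong -1ℤ y≋y^1)) ≋-refl

    E≥0 : ∀ k → 0ℤ ℤ.≤ coeff E k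
    E≥0 zero    = subst (0ℤ ℤ.≤_) (sym (trans (at E≋ 0) (coeff-1-y^-< 1 Z z<s))) (1-y^≥0 (p ℕ.* q) odd-pq 0)
    E≥0 (suc l) = subst (0ℤ ℤ.≤_) (sym (trans (at E≋ (suc l)) (coeff-1-y^ 1 Z l refl)))
      (ℤ.+-mono-≤ (1-y^≥0 (p ℕ.* q) odd-pq (suc l)) (1-y^≥0 (p ℕ.* q) odd-pq l))

    E-vanish : ∀ k → suc (p ℕ.* q) < k → coeff E k ≡ 0ℤ
    E-vanish k lt = *ₚ-vanish⁺ {Z} (1-y^-Lead (p ℕ.* q) (ℕ.*-mono-< 0<p 0<q) odd-pq) (1ₚ -ₚ y) 1
      (proj₂ (proj₂ 1-y-monic)) k lt

  -- The factors 1 + x^p and 1 + x^q change no coefficient below `p`, so there `c` agrees with `E`.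
  -- This keeps f₂ free of exponents below `p`.
  c-low : ∀ k → k < p → 0ℤ ℤ.≤ c k
  c-low k k<p = subst (0ℤ ℤ.≤_) (begin
    coeff E k                          ≡⟨ at D-factor k ⟨
    coeff ((1ₚ -ₚ y ^ₚ p) *ₚ D) k      ≡⟨ coeff-1-y^-< p D k<p ⟩
    coeff D k                          ≡⟨ coeff-1-y^-< q (Ψ y) (ℕ.<-trans k<p p<q) ⟩
    coeff (Ψ y) k                      ≡⟨ c≡Ψ k ⟨
    c k                                ∎) (E≥0 k)
    where open ≡-Reasoning

  module _ {t} (t+p+q≡ : t ℕ.+ p ℕ.+ q ≡ suc (p ℕ.* q)) where

    -- `E` vanishes beyond p q + 1 = t + p + q; removing the monic factors of degrees `p` and `q`
    -- leaves degree at most `t`.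
    c-vanish : ∀ k → t < k → c k ≡ 0ℤ
    c-vanish k t<k = trans (c≡Ψ k)
      (*ₚ-vanish⁻ (1-y^-Lead q 0<q odd-q) (Ψ y) (suc t) (λ k le →
        trans (at (*ₚ-comm (Ψ y) (1ₚ -ₚ y ^ₚ q)) k)
          (*ₚ-vanish⁻ (1-y^-Lead p 0<p odd-p) D (suc t ℕ.+ q) (λ k le →
            trans (at (≋-trans (*ₚ-comm D (1ₚ -ₚ y ^ₚ p)) D-factor) k)
              (E-vanish k (subst (_≤ k) (cong suc bound) le))) k le)) k t<k)
      where
      bound : t ℕ.+ q ℕ.+ p ≡ suc (p ℕ.* q)
      bound = trans (trans (ℕ.+-assoc t q p) (trans (cong (t ℕ.+_) (ℕ.+-comm q p)) (sym (ℕ.+-assoc t p q)))) t+p+q≡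

    -- The mirror image of `c-low`. At place p + q + k the product is a sum of four coefficients of
    -- Φ_2pq; those at p + q + k, p + k and q + k lie beyond `t`, so c k is a coefficient of `E`.
    c-high : ∀ k → t < k ℕ.+ p → 0ℤ ℤ.≤ c k
    c-high k t<k+p = subst (0ℤ ℤ.≤_) (begin
      coeff E (p ℕ.+ (q ℕ.+ k))
        ≡⟨ at D-factor (p ℕ.+ (q ℕ.+ k)) ⟨
      coeff ((1ₚ -ₚ y ^ₚ p) *ₚ D) (p ℕ.+ (q ℕ.+ k))
        ≡⟨ coeff-1-y^ p D (q ℕ.+ k) odd-p ⟩
      coeff D (p ℕ.+ (q ℕ.+ k)) ℤ.+ coeff D (q ℕ.+ k)
        ≡⟨ cong (λ m → coeff D m ℤ.+ coeff D (q ℕ.+ k)) (swap p q k) ⟩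
      coeff D (q ℕ.+ (p ℕ.+ k)) ℤ.+ coeff D (q ℕ.+ k)
        ≡⟨ cong₂ ℤ._+_ (coeff-1-y^ q (Ψ y) (p ℕ.+ k) odd-q) (coeff-1-y^ q (Ψ y) k odd-q) ⟩
      (coeff (Ψ y) (q ℕ.+ (p ℕ.+ k)) ℤ.+ coeff (Ψ y) (p ℕ.+ k)) ℤ.+ (coeff (Ψ y) (q ℕ.+ k) ℤ.+ coeff (Ψ y) k)
        ≡⟨ cong₂ ℤ._+_ (cong₂ ℤ._+_ (zero-at (ℕ.≤-trans t<p+k (ℕ.m≤n+m _ q))) (zero-at t<p+k))
                       (cong (ℤ._+ coeff (Ψ y) k) (zero-at (ℕ.<-≤-trans t<p+k (ℕ.+-monoˡ-≤ k (ℕ.<⇒≤ p<q))))) ⟩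
      0ℤ ℤ.+ (0ℤ ℤ.+ coeff (Ψ y) k)
        ≡⟨ trans (ℤ.+-identityˡ _) (ℤ.+-identityˡ _) ⟩
      coeff (Ψ y) k
        ≡⟨ c≡Ψ k ⟨
      c k ∎) (E≥0 (p ℕ.+ (q ℕ.+ k)))
      where
      open ≡-Reasoning
      t<p+k : t < p ℕ.+ k
      t<p+k = subst (t <_) (ℕ.+-comm k p) t<k+p
      zero-at : ∀ {k} → t < k → coeff (Ψ y) k ≡ 0ℤ
      zero-at {k} lt = trans (sym (c≡Ψ k)) (c-vanish k lt)
      swap : ∀ p q k → p ℕ.+ (q ℕ.+ k) ≡ q ℕ.+ (p ℕ.+ k)
      swap = ℕSolver.solve-∀

-- Numbers i p + j q of a given parity

-- Reducing `u` modulo `q` gives α, and the multiple of p q removed from u p comes off v q to give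
-- β′. The last equation is complementary to this one, since β q + β′ q = p q = α p + α′ p.
bézout⇒Inverses : ∀ {p q} → 1 < q → ∀ u v → suc (v ℕ.* q) ≡ u ℕ.* p → Inverses p q
bézout⇒Inverses {p} {q@(suc q-1)} 1<q u v e = inverses a a′ b b′ α+α′≡q β+β′≡p αp≡ βq≡
  where
  a = u ℕ.% q
  t = u ℕ./ q

  split : suc (v ℕ.* q) ≡ a ℕ.* p ℕ.+ (t ℕ.* p) ℕ.* q
  split = trans e (trans (cong (ℕ._* p) (m≡m%n+[m/n]*n u q)) (regroup a t p q))
    where
    regroup : ∀ a t p q → (a ℕ.+ t ℕ.* q) ℕ.* p ≡ a ℕ.* p ℕ.+ (t ℕ.* p) ℕ.* q
    regroup = ℕSolver.solve-∀

  -- Otherwise (v + 1) q ≤ t p q ≤ 1 + v q, against q > 1.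
  tp≤v : t ℕ.* p ≤ v
  tp≤v = ℕ.≮⇒≥ λ v<tp → ℕ.<-irrefl refl (begin-strict
    suc (v ℕ.* q)                      <⟨ ℕ.+-monoˡ-< (v ℕ.* q) 1<q ⟩
    suc v ℕ.* q                        ≤⟨ ℕ.*-monoˡ-≤ q v<tp ⟩
    (t ℕ.* p) ℕ.* q                    ≤⟨ ℕ.m≤n+m _ (a ℕ.* p) ⟩
    a ℕ.* p ℕ.+ (t ℕ.* p) ℕ.* q        ≡⟨ split ⟨
    suc (v ℕ.* q)                      ∎)
    where open ℕ.≤-Reasoning

  b′ = v ℕ.∸ t ℕ.* p

  αp≡ : a ℕ.* p ≡ suc (b′ ℕ.* q)
  αp≡ = ℕ.+-cancelʳ-≡ ((t ℕ.* p) ℕ.* q) _ _ (trans (sym split)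
    (cong suc (trans (cong (ℕ._* q) (sym (ℕ.m∸n+n≡m tp≤v))) (ℕ.*-distribʳ-+ q b′ (t ℕ.* p)))))

  a≤q : a ≤ q
  a≤q = ℕ.<⇒≤ (m%n<n u q)

  b′≤p : b′ ≤ p
  b′≤p = ℕ.*-cancelʳ-≤ b′ p q (begin
    b′ ℕ.* q         ≤⟨ ℕ.n≤1+n _ ⟩
    suc (b′ ℕ.* q)   ≡⟨ αp≡ ⟨
    a ℕ.* p          ≤⟨ ℕ.*-monoˡ-≤ p a≤q ⟩
    q ℕ.* p          ≡⟨ ℕ.*-comm q p ⟩
    p ℕ.* q          ∎)
    where open ℕ.≤-Reasoning

  a′ = q ℕ.∸ a
  b = p ℕ.∸ b′

  α+α′≡q : a ℕ.+ a′ ≡ q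
  α+α′≡q = ℕ.m+[n∸m]≡n a≤q

  β+β′≡p : b ℕ.+ b′ ≡ p
  β+β′≡p = ℕ.m∸n+n≡m b′≤p

  βq≡ : b ℕ.* q ≡ suc (a′ ℕ.* p)
  βq≡ = ℕ.+-cancelʳ-≡ (b′ ℕ.* q) _ _ (begin
    b ℕ.* q ℕ.+ b′ ℕ.* q            ≡⟨ ℕ.*-distribʳ-+ q b b′ ⟨
    (b ℕ.+ b′) ℕ.* q                ≡⟨ cong (ℕ._* q) β+β′≡p ⟩
    p ℕ.* q                         ≡⟨ ℕ.*-comm p q ⟩
    q ℕ.* p                         ≡⟨ cong (ℕ._* p) α+α′≡q ⟨
    (a ℕ.+ a′) ℕ.* p                ≡⟨ ℕ.*-distribʳ-+ p a a′ ⟩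
    a ℕ.* p ℕ.+ a′ ℕ.* p            ≡⟨ cong (ℕ._+ a′ ℕ.* p) αp≡ ⟩
    suc (b′ ℕ.* q) ℕ.+ a′ ℕ.* p     ≡⟨ cong suc (ℕ.+-comm (b′ ℕ.* q) (a′ ℕ.* p)) ⟩
    suc (a′ ℕ.* p) ℕ.+ b′ ℕ.* q     ∎)
    where open ≡-Reasoning

coprime⇒Inverses : ∀ {p q} → 1 < p → 1 < q → Coprime p q → Inverses p q
coprime⇒Inverses 1<p 1<q cop with coprime-Bézout cop
... | Bézout.+- u v e = bézout⇒Inverses 1<q u v e
-- Here 1 + u p = v q. `Inverses` is symmetric under exchanging `p` with `q` and α with β.
... | Bézout.-+ u v e with bézout⇒Inverses 1<p v u e
...   | inverses a a′ b b′ e₁ e₂ e₃ e₄ = inverses b b′ a a′ e₂ e₁ e₄ e₃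

-- The elements i p + j q with i ≤ r and j ≤ s of a fixed parity: consecutive
-- ones differ by at most W = 2 p + q - 2, by stepping from (i , j) to
-- (i + 2 , j), to (i - 1 , j + 1), or, when i = 0 and r = 1, to (1 , j + 1).
module Lattice (p q r s W : ℕ) (1≤r : 1 ≤ r) (1<p : 1 < p) (p<q : p < q)
  (W+2≡ : 2 ℕ.+ W ≡ p ℕ.+ p ℕ.+ q)
  (odd-p : -1ℤ ℤ.^ p ≡ -1ℤ) (odd-q : -1ℤ ℤ.^ q ≡ -1ℤ) where

  top : ℕ
  top = r ℕ.* p ℕ.+ s ℕ.* q

  -- The index `e` is the sign (-1)^k: 1 selects the even elements and -1 the odd ones.
  data Element (e : ℤ) : ℕ → Set where
    element : ∀ {i j} → i ≤ r → j ≤ s → -1ℤ ℤ.^ (i ℕ.* p ℕ.+ j ℕ.* q) ≡ e → Element e (i ℕ.* p ℕ.+ j ℕ.* q)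

  private
    sgn : ℕ → ℤ
    sgn k = -1ℤ ℤ.^ k

    sgn-+odd : ∀ k {m} → sgn m ≡ -1ℤ → sgn (k ℕ.+ m) ≡ ℤ.- sgn k
    sgn-+odd k {m} odd = trans (ℤ.^-distribˡ-+-* -1ℤ k m)
      (trans (cong (sgn k ℤ.*_) odd) (trans (ℤ.*-comm (sgn k) -1ℤ) (ℤ.-1*i≡-i (sgn k))))

    2p≤W : p ℕ.+ p ≤ W
    2p≤W = ℕ.+-cancelˡ-≤ 2 _ _ (begin
      2 ℕ.+ (p ℕ.+ p)   ≤⟨ ℕ.+-monoˡ-≤ (p ℕ.+ p) (ℕ.≤-trans 1<p (ℕ.<⇒≤ p<q)) ⟩
      q ℕ.+ (p ℕ.+ p)   ≡⟨ ℕ.+-comm q (p ℕ.+ p) ⟩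
      p ℕ.+ p ℕ.+ q     ≡⟨ W+2≡ ⟨
      2 ℕ.+ W           ∎)
      where open ℕ.≤-Reasoning

    p+q≤W : p ℕ.+ q ≤ W
    p+q≤W = ℕ.+-cancelˡ-≤ 2 _ _ (begin
      2 ℕ.+ (p ℕ.+ q)   ≤⟨ ℕ.+-monoˡ-≤ (p ℕ.+ q) 1<p ⟩
      p ℕ.+ (p ℕ.+ q)   ≡⟨ ℕ.+-assoc p p q ⟨
      p ℕ.+ p ℕ.+ q     ≡⟨ W+2≡ ⟨
      2 ℕ.+ W           ∎)
      where open ℕ.≤-Reasoning

    0<p : 0 < p
    0<p = ℕ.<-trans z<s 1<p

    Next : ℤ → ℕ → Set
    Next e k = ∃[ k′ ] Element e k′ × k < k′ × k′ ≤ k ℕ.+ W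

    right-2 : ∀ {e} i j → 2 ℕ.+ i ≤ r → j ≤ s → sgn (i ℕ.* p ℕ.+ j ℕ.* q) ≡ e → Next e (i ℕ.* p ℕ.+ j ℕ.* q)
    right-2 i j i+2≤r j≤s refl = _ ,
      element i+2≤r j≤s (trans (cong sgn shift)
        (trans (sgn-+odd (k ℕ.+ p) odd-p) (trans (cong ℤ.-_ (sgn-+odd k odd-p)) (ℤ.neg-involutive _)))) ,
      subst (k <_) (sym shift) (ℕ.<-≤-trans (ℕ.m<m+n k 0<p) (ℕ.m≤m+n _ p)) ,
      subst (_≤ k ℕ.+ W) (sym (trans shift (ℕ.+-assoc k p p))) (ℕ.+-monoʳ-≤ k 2p≤W)
      where
      k = i ℕ.* p ℕ.+ j ℕ.* q
      shift : (2 ℕ.+ i) ℕ.* p ℕ.+ j ℕ.* q ≡ k ℕ.+ p ℕ.+ p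
      shift = lemma i j p q
        where
        lemma : ∀ i j p q → (2 ℕ.+ i) ℕ.* p ℕ.+ j ℕ.* q ≡ i ℕ.* p ℕ.+ j ℕ.* q ℕ.+ p ℕ.+ p
        lemma = ℕSolver.solve-∀

    up-left : ∀ {e} i j → suc i ≤ r → suc j ≤ s → sgn (suc i ℕ.* p ℕ.+ j ℕ.* q) ≡ e → Next e (suc i ℕ.* p ℕ.+ j ℕ.* q)
    up-left i j i<r j<s refl = k′ ,
      element (ℕ.<⇒≤ i<r) j<s (ℤ.neg-injective (trans (sym (sgn-+odd k′ odd-p)) (trans (cong sgn shift) (sgn-+odd k odd-q)))) ,
      ℕ.+-cancelʳ-< p k k′ (subst (k ℕ.+ p <_) (sym shift) (ℕ.+-monoʳ-< k p<q)) ,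
      ℕ.≤-trans (ℕ.m≤m+n k′ p) (subst (_≤ k ℕ.+ W) (sym shift)
        (ℕ.+-monoʳ-≤ k (ℕ.≤-trans (ℕ.m≤n+m q p) p+q≤W)))
      where
      k = suc i ℕ.* p ℕ.+ j ℕ.* q
      k′ = i ℕ.* p ℕ.+ suc j ℕ.* q
      shift : k′ ℕ.+ p ≡ k ℕ.+ q
      shift = lemma i j p q
        where
        lemma : ∀ i j p q → i ℕ.* p ℕ.+ suc j ℕ.* q ℕ.+ p ≡ suc i ℕ.* p ℕ.+ j ℕ.* q ℕ.+ q
        lemma = ℕSolver.solve-∀

    up-right : ∀ {e} j → suc j ≤ s → sgn (j ℕ.* q) ≡ e → Next e (j ℕ.* q)
    up-right j j<s refl = _ ,
      element 1≤r j<s (trans (cong sgn shift)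
        (trans (sgn-+odd (k ℕ.+ p) odd-q) (trans (cong ℤ.-_ (sgn-+odd k odd-p)) (ℤ.neg-involutive _)))) ,
      subst (k <_) (sym shift) (ℕ.<-≤-trans (ℕ.m<m+n k 0<p) (ℕ.m≤m+n _ q)) ,
      subst (_≤ k ℕ.+ W) (sym (trans shift (ℕ.+-assoc k p q))) (ℕ.+-monoʳ-≤ k p+q≤W)
      where
      k = j ℕ.* q
      shift : 1 ℕ.* p ℕ.+ suc j ℕ.* q ≡ k ℕ.+ p ℕ.+ q
      shift = lemma j p q
        where
        lemma : ∀ j p q → 1 ℕ.* p ℕ.+ suc j ℕ.* q ≡ j ℕ.* q ℕ.+ p ℕ.+ q
        lemma = ℕSolver.solve-∀

    -- No step applies only when j = s and `i` is `r` or r - 1, that is at `top` or at top - p.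
    -- These two have opposite parities, so each parity has a single last element.
    next : ∀ {e k} → Element e k → (k ≡ top ⊎ k ℕ.+ p ≡ top) ⊎ Next e k
    next (element {i} {j} i≤r j≤s sgn≡) with ℕ.≤-<-connex (2 ℕ.+ i) r
    ... | inj₁ i+2≤r = inj₂ (right-2 i j i+2≤r j≤s sgn≡)
    ... | inj₂ r<i+2 with ℕ.m≤n⇒m<n∨m≡n j≤s
    next (element {zero}  {j} i≤r j≤s sgn≡) | inj₂ _ | inj₁ j<s = inj₂ (up-right j j<s sgn≡)
    next (element {suc i} {j} i≤r j≤s sgn≡) | inj₂ _ | inj₁ j<s = inj₂ (up-left i j i≤r j<s sgn≡)
    next (element {i} {j} i≤r j≤s sgn≡) | inj₂ r<i+2 | inj₂ refl with ℕ.m≤n⇒m<n∨m≡n i≤r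
    ... | inj₂ refl = inj₁ (inj₁ refl)
    ... | inj₁ i<r with ℕ.≤-antisym i<r (ℕ.≤-pred r<i+2)
    ...   | refl = inj₁ (inj₂ (lemma i j p q))
      where
      lemma : ∀ i j p q → i ℕ.* p ℕ.+ j ℕ.* q ℕ.+ p ≡ suc i ℕ.* p ℕ.+ j ℕ.* q
      lemma = ℕSolver.solve-∀

    -- Induction moves the upper end m = suc d + first of the window up by one. The current `k` is
    -- kept until m reaches k + W; then its successor k′ ≤ k + W = m takes over and exceeds `k`, so
    -- it lies in the window below m + 1. The bound on m prevents `k` from being `last` at that
    -- moment.
    window : ∀ {e first last} → Element e first →
      (∀ {k} → Element e k → k ≡ top ⊎ k ℕ.+ p ≡ top → k ≡ last) →
      ∀ d → suc d ℕ.+ first ≤ last ℕ.+ W →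
      ∃[ k ] Element e k × k < suc d ℕ.+ first × suc d ℕ.+ first ≤ k ℕ.+ W
    window {first = f} f∈ ends zero le = f , f∈ , ℕ.≤-refl ,
      subst (_≤ f ℕ.+ W) (ℕ.+-comm f 1) (ℕ.+-monoʳ-≤ f (ℕ.≤-trans (ℕ.≤-trans 0<p (ℕ.m≤m+n p p)) 2p≤W))
    window {first = f} f∈ ends (suc d) le with window f∈ ends d (ℕ.≤-trans (ℕ.n≤1+n _) le)
    ... | k , k∈ , k<m , m≤k+W with ℕ.m≤n⇒m<n∨m≡n m≤k+W
    ...   | inj₁ m<k+W = k , k∈ , ℕ.m≤n⇒m≤1+n k<m , m<k+W
    ...   | inj₂ m≡k+W with next k∈
    ...     | inj₁ end = contradiction (subst (λ z → suc (suc d ℕ.+ f) ≤ z ℕ.+ W) (sym (ends k∈ end)) le)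
                           (ℕ.<⇒≱ (s≤s (ℕ.≤-reflexive (sym m≡k+W))))
    ...     | inj₂ (k′ , k′∈ , k<k′ , k′≤k+W) = k′ , k′∈ , s≤s (ℕ.≤-trans k′≤k+W (ℕ.≤-reflexive (sym m≡k+W))) ,
                subst (λ z → suc z ≤ k′ ℕ.+ W) (sym m≡k+W) (ℕ.+-monoˡ-≤ W k<k′)

    sgn-Element : ∀ {e k} → Element e k → sgn k ≡ e
    sgn-Element (element _ _ sgn≡) = sgn≡

  module _ (even-top : -1ℤ ℤ.^ top ≡ 1ℤ) where

    top-element : Element 1ℤ top
    top-element = element ℕ.≤-refl ℕ.≤-refl even-top

    below : ℕ
    below = ℕ.pred r ℕ.* p ℕ.+ s ℕ.* q

    below+p≡top : below ℕ.+ p ≡ top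
    below+p≡top = trans (lemma (ℕ.pred r) s p q)
        (cong (λ r → r ℕ.* p ℕ.+ s ℕ.* q) (ℕ.suc-pred r {{ℕ.>-nonZero 1≤r}}))
      where
      lemma : ∀ i j p q → i ℕ.* p ℕ.+ j ℕ.* q ℕ.+ p ≡ suc i ℕ.* p ℕ.+ j ℕ.* q
      lemma = ℕSolver.solve-∀

    below-element : Element -1ℤ below
    below-element = element ℕ.pred[n]≤n ℕ.≤-refl (ℤ.neg-injective
      (trans (sym (sgn-+odd below odd-p)) (trans (cong sgn below+p≡top) even-top)))

    even-window : ∀ m → 0 < m → m ≤ top ℕ.+ W → ∃[ k ] Element 1ℤ k × k < m × m ≤ k ℕ.+ W
    even-window (suc d) _ le = subst (λ m → ∃[ k ] Element 1ℤ k × k < m × m ≤ k ℕ.+ W) (ℕ.+-identityʳ (suc d))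
      (window (element z≤n z≤n refl) ends d (subst (_≤ top ℕ.+ W) (sym (ℕ.+-identityʳ (suc d))) le))
      where
      ends : ∀ {k} → Element 1ℤ k → k ≡ top ⊎ k ℕ.+ p ≡ top → k ≡ top
      ends k∈ (inj₁ k≡top)   = k≡top
      ends {k} k∈ (inj₂ k+p≡top) = contradiction
        (trans (sym even-top) (trans (cong sgn (sym k+p≡top)) (trans (sgn-+odd k odd-p) (cong ℤ.-_ (sgn-Element k∈)))))
        λ ()

    odd-window : ∀ m → p < m → m ≤ below ℕ.+ W → ∃[ k ] Element -1ℤ k × k < m × m ≤ k ℕ.+ W
    odd-window m p<m le with ℕ.m≤n⇒∃[o]m+o≡n p<m
    ... | d , refl = subst (λ m → ∃[ k ] Element -1ℤ k × k < m × m ≤ k ℕ.+ W) eq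
      (window (element {i = 1} {j = 0} 1≤r z≤n (trans (cong sgn one) odd-p)) ends d
        (subst (_≤ below ℕ.+ W) (sym eq) le))
      where
      one : 1 ℕ.* p ℕ.+ 0 ℕ.* q ≡ p
      one = trans (ℕ.+-identityʳ _) (ℕ.+-identityʳ p)
      eq : suc d ℕ.+ (1 ℕ.* p ℕ.+ 0 ℕ.* q) ≡ suc p ℕ.+ d
      eq = cong suc (trans (cong (d ℕ.+_) one) (ℕ.+-comm d p))
      ends : ∀ {k} → Element -1ℤ k → k ≡ top ⊎ k ℕ.+ p ≡ top → k ≡ below
      ends k∈ (inj₁ k≡top)   = contradiction (trans (sym (sgn-Element k∈)) (trans (cong sgn k≡top) even-top)) λ ()
      ends {k} k∈ (inj₂ k+p≡top) = ℕ.+-cancelʳ-≡ p k below (trans k+p≡top (sym below+p≡top))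

-- Euler's totient

Σ₁ : (ℕ → ℕ) → ℕ → ℕ
Σ₁ f zero    = 0
Σ₁ f (suc n) = f (suc n) ℕ.+ Σ₁ f n

Σ₁-cong : ∀ {f g} → (∀ k → f k ≡ g k) → ∀ n → Σ₁ f n ≡ Σ₁ g n
Σ₁-cong e zero    = refl
Σ₁-cong e (suc n) = cong₂ ℕ._+_ (e (suc n)) (Σ₁-cong e n)

Σ₁-distrib-+ : ∀ f g n → Σ₁ (λ k → f k ℕ.+ g k) n ≡ Σ₁ f n ℕ.+ Σ₁ g n
Σ₁-distrib-+ f g zero    = refl
Σ₁-distrib-+ f g (suc n) = trans (cong (f (suc n) ℕ.+ g (suc n) ℕ.+_) (Σ₁-distrib-+ f g n))
  (interchange (f (suc n)) (g (suc n)) (Σ₁ f n) (Σ₁ g n))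
  where
  interchange : ∀ a b c d → a ℕ.+ b ℕ.+ (c ℕ.+ d) ≡ a ℕ.+ c ℕ.+ (b ℕ.+ d)
  interchange = ℕSolver.solve-∀

Σ₁-split : ∀ f a b → Σ₁ f (a ℕ.+ b) ≡ Σ₁ (λ k → f (k ℕ.+ b)) a ℕ.+ Σ₁ f b
Σ₁-split f zero    b = refl
Σ₁-split f (suc a) b = trans (cong (f (suc a ℕ.+ b) ℕ.+_) (Σ₁-split f a b)) (sym (ℕ.+-assoc (f (suc a ℕ.+ b)) _ _))

Σ₁-zero : ∀ f n → (∀ k → 0 < k → k ≤ n → f k ≡ 0) → Σ₁ f n ≡ 0
Σ₁-zero f zero    z = refl
Σ₁-zero f (suc n) z = cong₂ ℕ._+_ (z (suc n) z<s ℕ.≤-refl) (Σ₁-zero f n λ k 0<k k≤n → z k 0<k (ℕ.m≤n⇒m≤1+n k≤n))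

Σ₁-periodic : ∀ f m → (∀ k → f (k ℕ.+ m) ≡ f k) → ∀ a → Σ₁ f (a ℕ.* m) ≡ a ℕ.* Σ₁ f m
Σ₁-periodic f m per zero    = refl
Σ₁-periodic f m per (suc a) = trans (Σ₁-split f m (a ℕ.* m))
  (cong₂ ℕ._+_ (Σ₁-cong (shift a) m) (Σ₁-periodic f m per a))
  where
  shift : ∀ a k → f (k ℕ.+ a ℕ.* m) ≡ f k
  shift zero    k = cong f (ℕ.+-identityʳ k)
  shift (suc a) k = trans (cong f (trans (cong (k ℕ.+_) (ℕ.+-comm m _)) (sym (ℕ.+-assoc k (a ℕ.* m) m))))
    (trans (per (k ℕ.+ a ℕ.* m)) (shift a k))

Σ₁-multiples : ∀ p .{{_ : NonZero p}} f → (∀ k → p ∤ k → f k ≡ 0) →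
               ∀ m → Σ₁ f (m ℕ.* p) ≡ Σ₁ (λ j → f (j ℕ.* p)) m
Σ₁-multiples p f z zero    = refl
Σ₁-multiples p@(suc p-1) f z (suc m) = trans (Σ₁-split f p (m ℕ.* p))
  (cong₂ ℕ._+_ (trans (cong (f (p ℕ.+ m ℕ.* p) ℕ.+_) (Σ₁-zero _ p-1 between)) (ℕ.+-identityʳ _))
               (Σ₁-multiples p f z m))
  where
  between : ∀ k → 0 < k → k ≤ p-1 → f (k ℕ.+ m ℕ.* p) ≡ 0
  between k@(suc _) _ k≤p-1 = z _ λ p∣ → ∣.>⇒∤ (s≤s k≤p-1)
    (∣.∣m+n∣m⇒∣n (subst (p ∣_) (ℕ.+-comm k _) p∣) (∣.n∣m*n m))

⟦_⟧ : ∀ {a} {A : Set a} → Dec A → ℕ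
⟦ d ⟧ = if does d then 1 else 0

length-filter≡Σ₁ : ∀ {a} {P : Pred ℕ a} (P? : Decidable P) n →
                   length (filter P? (map suc (upTo n))) ≡ Σ₁ (λ k → ⟦ P? k ⟧) n
length-filter≡Σ₁ P? zero    = refl
length-filter≡Σ₁ P? (suc n) = begin
  length (filter P? (map suc (upTo (suc n))))
    ≡⟨ cong (length ∘ filter P? ∘ map suc) (List.upTo-∷ʳ n) ⟨
  length (filter P? (map suc (upTo n ++ n ∷ [])))
    ≡⟨ cong (length ∘ filter P?) (List.map-++ suc (upTo n) (n ∷ [])) ⟩
  length (filter P? (map suc (upTo n) ++ suc n ∷ []))
    ≡⟨ cong length (List.filter-++ P? (map suc (upTo n)) (suc n ∷ [])) ⟩
  length (filter P? (map suc (upTo n)) ++ filter P? (suc n ∷ []))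
    ≡⟨ List.length-++ (filter P? (map suc (upTo n))) ⟩
  length (filter P? (map suc (upTo n))) ℕ.+ length (filter P? (suc n ∷ []))
    ≡⟨ cong₂ ℕ._+_ (length-filter≡Σ₁ P? n) single ⟩
  Σ₁ (λ k → ⟦ P? k ⟧) n ℕ.+ ⟦ P? (suc n) ⟧
    ≡⟨ ℕ.+-comm _ ⟦ P? (suc n) ⟧ ⟩
  Σ₁ (λ k → ⟦ P? k ⟧) (suc n) ∎
  where
  open ≡-Reasoning
  single : length (filter P? (suc n ∷ [])) ≡ ⟦ P? (suc n) ⟧
  single with does (P? (suc n))
  ... | true  = refl
  ... | false = refl

⟦coprime⟧-⇔ : ∀ a b c d → (Coprime a b → Coprime c d) → (Coprime c d → Coprime a b) →
              ⟦ coprime? a b ⟧ ≡ ⟦ coprime? c d ⟧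
⟦coprime⟧-⇔ a b c d f g = cong (if_then 1 else 0) (does-⇔ (mk⇔ {A = Coprime a b} {B = Coprime c d} f g) (coprime? a b) (coprime? c d))

⟦⟧-no : ∀ {a} {A : Set a} (d : Dec A) → ¬ A → ⟦ d ⟧ ≡ 0
⟦⟧-no (yes a) ¬a = contradiction a ¬a
⟦⟧-no (no _)  ¬a = refl

φ≡Σ₁ : ∀ n → φ n ≡ Σ₁ (λ k → ⟦ coprime? n k ⟧) n
φ≡Σ₁ n = length-filter≡Σ₁ (coprime? n) n

coprime-*ʳ : ∀ {k a b} → Coprime k a → Coprime k b → Coprime k (a ℕ.* b)
coprime-*ʳ {k} {a} {b} k⊥a k⊥b {d} (d∣k , d∣ab) = k⊥b (d∣k , coprime-divisor d⊥a d∣ab)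
  where
  d⊥a : Coprime d a
  d⊥a (e∣d , e∣a) = k⊥a (∣.∣-trans e∣d d∣k , e∣a)

-- Both sides count the k ≤ p m coprime to `m`. Periodicity modulo `m` gives p φ(m). Among them
-- those not divisible by `p` are the k coprime to p m, and the multiples j p correspond to the j ≤
-- m coprime to `m`.
φ-prime-* : ∀ {p m} → Prime p → p ∤ m → φ (p ℕ.* m) ℕ.+ φ m ≡ p ℕ.* φ m
φ-prime-* {p} {m} pr p∤m = begin
  φ (p ℕ.* m) ℕ.+ φ m
    ≡⟨ cong₂ ℕ._+_ (φ≡Σ₁ (p ℕ.* m)) (φ≡Σ₁ m) ⟩
  Σ₁ h (p ℕ.* m) ℕ.+ Σ₁ f m
    ≡⟨ cong (Σ₁ h (p ℕ.* m) ℕ.+_) (Σ₁-cong f≡g m) ⟩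
  Σ₁ h (p ℕ.* m) ℕ.+ Σ₁ (λ j → g (j ℕ.* p)) m
    ≡⟨ cong (Σ₁ h (p ℕ.* m) ℕ.+_) (Σ₁-multiples p g g≡0 m) ⟨
  Σ₁ h (p ℕ.* m) ℕ.+ Σ₁ g (m ℕ.* p)
    ≡⟨ cong (λ k → Σ₁ h (p ℕ.* m) ℕ.+ Σ₁ g k) (ℕ.*-comm m p) ⟩
  Σ₁ h (p ℕ.* m) ℕ.+ Σ₁ g (p ℕ.* m)
    ≡⟨ Σ₁-distrib-+ h g (p ℕ.* m) ⟨
  Σ₁ (λ k → h k ℕ.+ g k) (p ℕ.* m)
    ≡⟨ Σ₁-cong h+g≡f (p ℕ.* m) ⟩
  Σ₁ f (p ℕ.* m)
    ≡⟨ Σ₁-periodic f m periodic p ⟩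
  p ℕ.* Σ₁ f m
    ≡⟨ cong (p ℕ.*_) (φ≡Σ₁ m) ⟨
  p ℕ.* φ m ∎
  where
  open ≡-Reasoning
  instance _ = prime⇒nonZero pr

  f g h : ℕ → ℕ
  f k = ⟦ coprime? m k ⟧
  g k = if does (p ∣? k) then f k else 0
  h k = ⟦ coprime? (p ℕ.* m) k ⟧

  m⊥p : Coprime m p
  m⊥p = prime∤⇒coprime pr p∤m

  periodic : ∀ k → f (k ℕ.+ m) ≡ f k
  periodic k = ⟦coprime⟧-⇔ m (k ℕ.+ m) m k
    (λ m⊥k+m (d∣m , d∣k) → m⊥k+m (d∣m , ∣.∣m∣n⇒∣m+n d∣k d∣m))
    (λ m⊥k {d} (d∣m , d∣k+m) → m⊥k (d∣m , ∣.∣m+n∣m⇒∣n (subst (d ∣_) (ℕ.+-comm k m) d∣k+m) d∣m))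

  g≡0 : ∀ k → p ∤ k → g k ≡ 0
  g≡0 k p∤k with p ∣? k
  ... | yes p∣k = contradiction p∣k p∤k
  ... | no  _   = refl

  f≡g : ∀ j → f j ≡ g (j ℕ.* p)
  f≡g j with p ∣? j ℕ.* p
  ... | no  p∤jp = contradiction (∣.n∣m*n j) p∤jp
  ... | yes _    = ⟦coprime⟧-⇔ m j m (j ℕ.* p)
    (λ m⊥j → coprime-*ʳ {m} {j} {p} m⊥j m⊥p)
    (λ m⊥jp (d∣m , d∣j) → m⊥jp (d∣m , ∣.∣m⇒∣m*n p d∣j))

  h+g≡f : ∀ k → h k ℕ.+ g k ≡ f k
  h+g≡f k with p ∣? k
  ... | yes p∣k = cong (ℕ._+ f k) (⟦⟧-no (coprime? (p ℕ.* m) k) λ pm⊥k →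
                    ℕ.<⇒≢ (prime⇒>1 pr) (sym (pm⊥k (∣.m∣m*n m , p∣k))))
  ... | no  p∤k = trans (ℕ.+-identityʳ _) (⟦coprime⟧-⇔ (p ℕ.* m) k m k
    (λ pm⊥k (d∣m , d∣k) → pm⊥k (∣.∣n⇒∣m*n p d∣m , d∣k))
    (λ m⊥k → Coprime.sym (coprime-*ʳ {k} {p} {m} (prime∤⇒coprime pr p∤k) (Coprime.sym {m} {k} m⊥k))))

-- `φ-prime-*` for 2 · (p q), p · q and q · 1 amounts to φ(n) = (p - 1) (q - 1). The additive form
-- matches `t+p+q≡`, so that φ(n) = t follows by cancellation.
φ-2pq : ∀ {p q} → Prime p → Prime q → 2 ∤ p → 2 ∤ q → p < q →
        φ (2 ℕ.* p ℕ.* q) ℕ.+ p ℕ.+ q ≡ suc (p ℕ.* q)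
φ-2pq {p} {q} p-prime q-prime 2∤p 2∤q p<q = begin
  φ (2 ℕ.* p ℕ.* q) ℕ.+ p ℕ.+ q
    ≡⟨ cong (λ n → φ n ℕ.+ p ℕ.+ q) (ℕ.*-assoc 2 p q) ⟩
  φ (2 ℕ.* (p ℕ.* q)) ℕ.+ p ℕ.+ q
    ≡⟨ cong (λ k → k ℕ.+ p ℕ.+ q) φ2pq≡ ⟩
  φ (p ℕ.* q) ℕ.+ p ℕ.+ q
    ≡⟨ cong (φ (p ℕ.* q) ℕ.+ p ℕ.+_) φq+1≡q ⟨
  φ (p ℕ.* q) ℕ.+ p ℕ.+ (φ q ℕ.+ 1)
    ≡⟨ regroup (φ (p ℕ.* q)) p (φ q) ⟩
  (φ (p ℕ.* q) ℕ.+ φ q) ℕ.+ p ℕ.+ 1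
    ≡⟨ cong (λ k → k ℕ.+ p ℕ.+ 1) (φ-prime-* p-prime p∤q) ⟩
  p ℕ.* φ q ℕ.+ p ℕ.+ 1
    ≡⟨ regroup′ p (φ q) ⟩
  suc (p ℕ.* (φ q ℕ.+ 1))
    ≡⟨ cong (λ k → suc (p ℕ.* k)) φq+1≡q ⟩
  suc (p ℕ.* q) ∎
  where
  open ≡-Reasoning
  regroup : ∀ a p b → a ℕ.+ p ℕ.+ (b ℕ.+ 1) ≡ (a ℕ.+ b) ℕ.+ p ℕ.+ 1
  regroup = ℕSolver.solve-∀
  regroup′ : ∀ p b → p ℕ.* b ℕ.+ p ℕ.+ 1 ≡ suc (p ℕ.* (b ℕ.+ 1))
  regroup′ = ℕSolver.solve-∀

  p∤q : p ∤ q
  p∤q p∣q with prime⇒irreducible q-prime p∣q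
  ... | inj₁ p≡1 = ℕ.<⇒≢ (prime⇒>1 p-prime) (sym p≡1)
  ... | inj₂ p≡q = ℕ.<⇒≢ p<q p≡q

  2∤pq : 2 ∤ p ℕ.* q
  2∤pq 2∣pq = 2∤q (coprime-divisor (Coprime.sym (prime∤⇒coprime prime[2] 2∤p)) 2∣pq)

  φ2pq≡ : φ (2 ℕ.* (p ℕ.* q)) ≡ φ (p ℕ.* q)
  φ2pq≡ = ℕ.+-cancelʳ-≡ (φ (p ℕ.* q)) _ _ (trans (φ-prime-* prime[2] 2∤pq)
    (cong (φ (p ℕ.* q) ℕ.+_) (ℕ.+-identityʳ _)))

  φq+1≡q : φ q ℕ.+ 1 ≡ q
  φq+1≡q = begin
    φ q ℕ.+ 1          ≡⟨ cong (λ k → φ k ℕ.+ 1) (ℕ.*-identityʳ q) ⟨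
    φ (q ℕ.* 1) ℕ.+ 1  ≡⟨ φ-prime-* q-prime (λ q∣1 → ℕ.<⇒≢ (prime⇒>1 q-prime) (sym (∣.∣1⇒≡1 q∣1))) ⟩
    q ℕ.* 1            ≡⟨ ℕ.*-identityʳ q ⟩
    q                  ∎

-- Shifts of Φ_n^T

coeff-x^-*ₚ : ∀ m f l → coeff (x^ m *ₚ f) (m + l) ≡ coeff f l
coeff-x^-*ₚ m f l = begin
  coeff (x^ m *ₚ f) (m + l)      ≡⟨ at (*ₚ-cong {g = f} (x^≋linear^ m) ≋-refl) (m + l) ⟩
  coeff (x ^ₚ m *ₚ f) (m + l)    ≡⟨ coeff-linear^-*ₚ 1ℤ m f l ⟩
  1ℤ ℤ.^ m ℤ.* coeff f l         ≡⟨ cong (ℤ._* coeff f l) (ℤ.^-zeroˡ m) ⟩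
  1ℤ ℤ.* coeff f l               ≡⟨ ℤ.*-identityˡ _ ⟩
  coeff f l                      ∎
  where open ≡-Reasoning

coeff-x^-*ₚ-< : ∀ m f {k} → k < m → coeff (x^ m *ₚ f) k ≡ 0ℤ
coeff-x^-*ₚ-< m f {k} k<m = trans (at (*ₚ-cong {g = f} (x^≋linear^ m) ≋-refl) k) (coeff-linear^-*ₚ-< 1ℤ m f k<m)

-- The exponents i + e below n do not wrap around modulo n: the quotient of
-- x^i f by x^n - 1 has degree less than i.
module _ n .{{_ : NonZero n}} (f : Poly) (f-small : ∀ k → n ≤ k → coeff f k ≡ 0ℤ) (i : ℕ) where
  private
    g Q ρ : Poly
    g = x^ n -ₚ 1ₚ
    Q = (x^ i *ₚ f) ÷ₚ g
    ρ = (x^ i *ₚ f) %ₚ g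

    lead = x^-1-Lead n
    division = proj₁ (divMod-spec {g} lead (x^ i *ₚ f))

  coeff-%ₚ-≥ : ∀ k → n ≤ k → coeff ρ k ≡ 0ℤ
  coeff-%ₚ-≥ = proj₂ (divMod-spec {g} lead (x^ i *ₚ f))

  private
    coeff-division : ∀ k → coeff (x^ i *ₚ f) k ≡ coeff (Q *ₚ g) k ℤ.+ coeff ρ k
    coeff-division k = trans (at division k) (coeff-+ₚ (Q *ₚ g) ρ k)

    Qg-vanish : ∀ k → i + n ≤ k → coeff (Q *ₚ g) k ≡ 0ℤ
    Qg-vanish k i+n≤k with ℕ.m≤n⇒∃[o]m+o≡n i+n≤k
    ... | o , refl = begin
      coeff (Q *ₚ g) k                   ≡⟨ ℤ.+-identityʳ _ ⟨
      coeff (Q *ₚ g) k ℤ.+ 0ℤ            ≡⟨ cong (λ z → coeff (Q *ₚ g) k ℤ.+ z) (coeff-%ₚ-≥ k (ℕ.≤-trans (ℕ.m≤n+m n i) i+n≤k)) ⟨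
      coeff (Q *ₚ g) k ℤ.+ coeff ρ k     ≡⟨ coeff-division k ⟨
      coeff (x^ i *ₚ f) (i + n + o)      ≡⟨ cong (coeff (x^ i *ₚ f)) (ℕ.+-assoc i n o) ⟩
      coeff (x^ i *ₚ f) (i + (n + o))    ≡⟨ coeff-x^-*ₚ i f (n + o) ⟩
      coeff f (n + o)                    ≡⟨ f-small (n + o) (ℕ.m≤m+n n o) ⟩
      0ℤ                                 ∎
      where open ≡-Reasoning

  coeff-%ₚ : ∀ e → i + e < n → coeff ρ (i + e) ≡ coeff f e
  coeff-%ₚ e i+e<n = sym (begin
    coeff f e                                        ≡⟨ coeff-x^-*ₚ i f e ⟨
    coeff (x^ i *ₚ f) k                              ≡⟨ coeff-division k ⟩
    coeff (Q *ₚ g) k ℤ.+ coeff ρ k                   ≡⟨ cong (ℤ._+ coeff ρ k) Qg≡0 ⟩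
    0ℤ ℤ.+ coeff ρ k                                 ≡⟨ ℤ.+-identityˡ _ ⟩
    coeff ρ k                                        ∎)
    where
    open ≡-Reasoning
    k = i + e
    expand : ∀ Q X → Q *ₚ (X -ₚ 1ₚ) ≋ X *ₚ Q -ₚ Q
    expand = solve-∀ polyACR
    -- At k < n the product Q (x^n - 1) has coefficient -Q_k, and Q vanishes from `i` on.
    Qg≡0 : coeff (Q *ₚ g) k ≡ 0ℤ
    Qg≡0 = trans (at (expand Q (x^ n)) k) (trans (coeff--ₚ (x^ n *ₚ Q) Q k)
      (cong₂ (λ a b → a ℤ.+ -1ℤ ℤ.* b) (coeff-x^-*ₚ-< n Q i+e<n)
        (*ₚ-vanish⁻ {g} lead Q i Qg-vanish k (ℕ.m≤m+n i e))))

indicator-≥0 : ∀ {c} → 0ℤ ℤ.≤ c → indicator -1ℤ c ≡ 0ℤ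
indicator-≥0 (+≤+ _) = refl

-- The exponents of Φ_n^T and the degrees of its shifts

module Main {p q : ℕ} (p-prime : Prime p) (q-prime : Prime q) (2∤p : 2 ∤ p) (2∤q : 2 ∤ q) (p<q : p < q)
  (I : Inverses p q) {r s : ℕ} (α≡1+r : Inverses.α I ≡ suc r) (1≤r : 1 ≤ r) (β≡1+s : Inverses.β I ≡ suc s) where

  open Inverses I
  open Coefficients p-prime q-prime 2∤p 2∤q p<q I

  -- `N` is n / 2. `W` counts the residues above the degree N + b of Φ_n^T (see `N+b+W≡`) and also
  -- bounds the gaps between lattice points of equal parity; part (1) rests on this coincidence.
  N n W : ℕ
  N = p * q
  n = 2 * p * q
  W = p + p + q ∸ 2

  instance
    _ = prime⇒nonZero p-prime
    _ = prime⇒nonZero q-prime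
    _ = ℕ.m*n≢0 2 p
    n≢0 = ℕ.m*n≢0 (2 * p) q

  1<p = prime⇒>1 p-prime
  0<p = ℕ.<-trans z<s 1<p
  1<q = ℕ.<-trans 1<p p<q

  W+2≡ : 2 + W ≡ p + p + q
  W+2≡ = ℕ.m+[n∸m]≡n (ℕ.≤-trans 1<p (ℕ.≤-trans (ℕ.m≤m+n p p) (ℕ.m≤m+n (p + p) q)))

  odd-p = odd-power p 2∤p
  odd-q = odd-power q 2∤q

  open Lattice p q r s W 1≤r 1<p p<q W+2≡ odd-p odd-q renaming (top to t)

  t+p+q≡ : t + p + q ≡ suc N
  t+p+q≡ = begin
    r * p + s * q + p + q      ≡⟨ regroup r s p q ⟩
    suc r * p + suc s * q      ≡⟨ cong₂ (λ a b → a * p + b * q) α≡1+r β≡1+s ⟨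
    α * p + β * q              ≡⟨ cong (_+ β * q) αp≡1+β′q ⟩
    suc (β′ * q + β * q)       ≡⟨ cong suc (trans (ℕ.+-comm (β′ * q) (β * q)) (sym (ℕ.*-distribʳ-+ q β β′))) ⟩
    suc ((β + β′) * q)         ≡⟨ cong (λ m → suc (m * q)) β+β′≡p ⟩
    suc (p * q)                ∎
    where
    open ≡-Reasoning
    regroup : ∀ r s p q → r * p + s * q + p + q ≡ suc r * p + suc s * q
    regroup = ℕSolver.solve-∀

  -- `p`, `q` and `N` are odd and t = N + 1 - p - q.
  even-t : -1ℤ ℤ.^ t ≡ 1ℤ
  even-t = begin
    -1ℤ ℤ.^ t                                         ≡⟨ solve 1 (λ a → a := a :* con -1ℤ :* con -1ℤ) refl (-1ℤ ℤ.^ t) ⟩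
    -1ℤ ℤ.^ t ℤ.* -1ℤ ℤ.* -1ℤ                         ≡⟨ cong₂ (λ a b → -1ℤ ℤ.^ t ℤ.* a ℤ.* b) odd-p odd-q ⟨
    -1ℤ ℤ.^ t ℤ.* -1ℤ ℤ.^ p ℤ.* -1ℤ ℤ.^ q             ≡⟨ cong (ℤ._* -1ℤ ℤ.^ q) (ℤ.^-distribˡ-+-* -1ℤ t p) ⟨
    -1ℤ ℤ.^ (t + p) ℤ.* -1ℤ ℤ.^ q                     ≡⟨ ℤ.^-distribˡ-+-* -1ℤ (t + p) q ⟨
    -1ℤ ℤ.^ (t + p + q)                               ≡⟨ cong (-1ℤ ℤ.^_) t+p+q≡ ⟩
    -1ℤ ℤ.* -1ℤ ℤ.^ (p * q)                           ≡⟨ cong (-1ℤ ℤ.*_) (ℤ.^-*-assoc -1ℤ p q) ⟨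
    -1ℤ ℤ.* (-1ℤ ℤ.^ p) ℤ.^ q                         ≡⟨ cong (λ a → -1ℤ ℤ.* a ℤ.^ q) odd-p ⟩
    -1ℤ ℤ.* -1ℤ ℤ.^ q                                 ≡⟨ cong (-1ℤ ℤ.*_) odd-q ⟩
    1ℤ                                                ∎
    where open ≡-Reasoning

  b : ℕ
  b = below even-t

  b+p≡t : b + p ≡ t
  b+p≡t = below+p≡top even-t

  n≡N+N : n ≡ N + N
  n≡N+N = double p q
    where
    double : ∀ p q → 2 * p * q ≡ p * q + p * q
    double = ℕSolver.solve-∀

  n/2≡N : n / 2 ≡ N
  n/2≡N = trans (cong (_/ 2) (half p q)) (m*n/n≡m N 2)
    where
    half : ∀ p q → 2 * p * q ≡ p * q * 2
    half = ℕSolver.solve-∀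

  t<N : t < N
  t<N = ℕ.≤-pred (begin
    2 + t          ≡⟨ ℕ.+-comm 2 t ⟩
    t + 2          ≤⟨ ℕ.+-monoʳ-≤ t (ℕ.≤-trans 1<p (ℕ.m≤m+n p q)) ⟩
    t + (p + q)    ≡⟨ ℕ.+-assoc t p q ⟨
    t + p + q      ≡⟨ t+p+q≡ ⟩
    suc N          ∎)
    where open ℕ.≤-Reasoning

  -- `even-window` thus reaches up to N + p - 1, and `odd-window`, shifted by `N`, covers N + p + 1
  -- to n - 1. The values of m = n - i left over are N + p and n, the two excluded shifts.
  t+W≡ : suc (t + W) ≡ N + p
  t+W≡ = ℕ.suc-injective (begin
    2 + (t + W)      ≡⟨ regroup₁ t W ⟩
    t + (2 + W)      ≡⟨ cong (t +_) W+2≡ ⟩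
    t + (p + p + q)  ≡⟨ regroup₂ t p q ⟩
    t + p + q + p    ≡⟨ cong (_+ p) t+p+q≡ ⟩
    suc N + p        ∎)
    where
    open ≡-Reasoning
    regroup₁ : ∀ t w → 2 + (t + w) ≡ t + (2 + w)
    regroup₁ = ℕSolver.solve-∀
    regroup₂ : ∀ t p q → t + (p + p + q) ≡ t + p + q + p
    regroup₂ = ℕSolver.solve-∀

  b+W≡ : suc (b + W) ≡ N
  b+W≡ = ℕ.+-cancelʳ-≡ p _ _ (trans (cong suc (regroup b W p)) (trans (cong (λ z → suc (z + W)) b+p≡t) t+W≡))
    where
    regroup : ∀ b w p → b + w + p ≡ b + p + w
    regroup = ℕSolver.solve-∀

  N+b+W≡ : suc (N + b) + W ≡ n
  N+b+W≡ = trans (regroup N b W) (trans (cong (N +_) b+W≡) (sym n≡N+N))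
    where
    regroup : ∀ n b w → suc (n + b) + w ≡ n + suc (b + w)
    regroup = ℕSolver.solve-∀

  c-element : ∀ {e k} → Element e k → c k ≡ e
  c-element (element {i} {j} i≤r j≤s sgn≡) =
    trans (c-lattice i j (subst (i <_) (sym α≡1+r) (s≤s i≤r)) (subst (j <_) (sym β≡1+s) (s≤s j≤s))) sgn≡

  element-≤ : ∀ {e k} → Element e k → k ≤ t
  element-≤ (element i≤r j≤s _) = ℕ.+-mono-≤ (ℕ.*-monoˡ-≤ p i≤r) (ℕ.*-monoˡ-≤ q j≤s)

  T : Poly
  T = ΦT n

  coeff-T : ∀ k → coeff T k ≡ indicator 1ℤ (c k) ℤ.+ coeff (x^ N *ₚ support -1ℤ (Φ n)) k
  coeff-T k = trans (cong (λ m → coeff (support 1ℤ (Φ n) +ₚ x^ m *ₚ support -1ℤ (Φ n)) k) n/2≡N)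
    (trans (coeff-+ₚ (support 1ℤ (Φ n)) (x^ N *ₚ support -1ℤ (Φ n)) k)
      (cong (ℤ._+ coeff (x^ N *ₚ support -1ℤ (Φ n)) k) (coeff-map (indicator 1ℤ) refl (Φ n) k)))

  coeff-T-< : ∀ {k} → k < N → coeff T k ≡ indicator 1ℤ (c k)
  coeff-T-< {k} k<N = trans (coeff-T k)
    (trans (cong (λ z → indicator 1ℤ (c k) ℤ.+ z) (coeff-x^-*ₚ-< N (support -1ℤ (Φ n)) k<N)) (ℤ.+-identityʳ _))

  coeff-T-+ : ∀ l → coeff T (N + l) ≡ indicator -1ℤ (c l)
  coeff-T-+ l = trans (coeff-T (N + l)) (trans
    (cong₂ ℤ._+_ (cong (indicator 1ℤ) (c-vanish t+p+q≡ (N + l) (ℕ.<-≤-trans t<N (ℕ.m≤m+n N l))))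
                 (trans (coeff-x^-*ₚ N (support -1ℤ (Φ n)) l) (coeff-map (indicator -1ℤ) refl (Φ n) l)))
    (ℤ.+-identityˡ _))

  T-even : ∀ {k} → Element 1ℤ k → coeff T k ≡ 1ℤ
  T-even k∈ = trans (coeff-T-< (ℕ.≤-<-trans (element-≤ k∈) t<N)) (cong (indicator 1ℤ) (c-element k∈))

  T-odd : ∀ {l} → Element -1ℤ l → coeff T (N + l) ≡ 1ℤ
  T-odd {l} l∈ = trans (coeff-T-+ l) (cong (indicator -1ℤ) (c-element l∈))

  -- From `N` on only f₂ contributes, and `c-high` rules out a coefficient -1 beyond b = t - p.
  T-above : ∀ k → N + b < k → coeff T k ≡ 0ℤ
  T-above k N+b<k with ℕ.m≤n⇒∃[o]m+o≡n (ℕ.≤-trans (ℕ.m≤m+n N b) (ℕ.<⇒≤ N+b<k))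
  ... | l , refl = trans (coeff-T-+ l) (indicator-≥0 (c-high t+p+q≡ l
    (subst (_< l + p) b+p≡t (ℕ.+-monoˡ-< p (ℕ.+-cancelˡ-< N b l N+b<k)))))

  deg-T : deg T ≡ N + b
  deg-T = deg-≡ T (T-odd (below-element even-t)) T-above

  T-small : ∀ k → n ≤ k → coeff T k ≡ 0ℤ
  T-small k n≤k = T-above k (ℕ.<-≤-trans
    (subst (N + b <_) N+b+W≡ (ℕ.m≤m+n (suc (N + b)) W)) n≤k)

  R-coeff : ∀ i e → i + e < n → coeff (R n i) (i + e) ≡ coeff T e
  R-coeff i = coeff-%ₚ n T T-small i

  -- e < m keeps i + e below n, and m ≤ e + W gives i + e ≥ n - W = deg T + 1.
  deg-R-> : ∀ i m e → i + m ≡ n → coeff T e ≡ 1ℤ → e < m → m ≤ e + W → deg (R n i) > deg T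
  deg-R-> i m e i+m≡n Te≡1 e<m m≤e+W = begin-strict
    deg T       ≡⟨ deg-T ⟩
    N + b       <⟨ ℕ.+-cancelʳ-≤ W _ _ (begin
                     suc (N + b) + W   ≡⟨ N+b+W≡ ⟩
                     n                 ≡⟨ i+m≡n ⟨
                     i + m             ≤⟨ ℕ.+-monoʳ-≤ i m≤e+W ⟩
                     i + (e + W)       ≡⟨ ℕ.+-assoc i e W ⟨
                     i + e + W         ∎) ⟩
    i + e       ≤⟨ deg-≥ (R n i) (λ z → contradiction (trans (sym Te≡1) (trans (sym (R-coeff i e i+e<n)) z)) λ ()) ⟩
    deg (R n i) ∎
    where
    open ℕ.≤-Reasoning
    i+e<n : i + e < n
    i+e<n = subst (i + e <_) i+m≡n (ℕ.+-monoʳ-< i e<m)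

  i₀ : ℕ
  i₀ = N ∸ p

  i₀+p≡N : i₀ + p ≡ N
  i₀+p≡N = ℕ.m∸n+n≡m (ℕ.m≤m*n p q)

  -- With m = n - i, an exponent of f₁ serves for m < N + p and one of x^N f₂ for m > N + p. i < n
  -- makes m positive; i ≢ 0 keeps m - N within reach of `odd-window`.
  part₁ : ∀ i → i < n → i ≢ 0 → i ≢ n / 2 ∸ p → deg (R n i) > deg T
  part₁ i i<n i≢0 i≢i₀ with ℕ.m≤n⇒∃[o]m+o≡n (ℕ.<⇒≤ i<n)
  ... | m , i+m≡n with ℕ.<-cmp m (N + p)
  ... | tri≈ _ refl _ = contradiction (ℕ.+-cancelʳ-≡ p i i₀ (trans i+p≡N (sym i₀+p≡N)))
                          (subst (λ h → i ≢ h ∸ p) n/2≡N i≢i₀)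
    where
    i+p≡N : i + p ≡ N
    i+p≡N = ℕ.+-cancelʳ-≡ N _ _ (trans (regroup i p N) (trans i+m≡n n≡N+N))
      where
      regroup : ∀ i p n → i + p + n ≡ i + (n + p)
      regroup = ℕSolver.solve-∀
  ... | tri< m<N+p _ _ with even-window even-t m 0<m (ℕ.≤-pred (subst (m <_) (sym t+W≡) m<N+p))
    where
    0<m : 0 < m
    0<m = ℕ.+-cancelˡ-< i 0 m (subst (_< i + m) (sym (ℕ.+-identityʳ i)) (subst (i <_) (sym i+m≡n) i<n))
  ...   | k , k∈ , k<m , m≤k+W = deg-R-> i m k i+m≡n (T-even k∈) k<m m≤k+W
  part₁ i i<n i≢0 i≢i₀ | m , i+m≡n | tri> _ _ N+p<m
    with ℕ.m≤n⇒∃[o]m+o≡n (ℕ.≤-trans (ℕ.m≤m+n N p) (ℕ.<⇒≤ N+p<m))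
  ... | m′ , refl with odd-window even-t m′ (ℕ.+-cancelˡ-< N p m′ N+p<m) m′≤b+W
    where
    m′≤b+W : m′ ≤ b + W
    m′≤b+W = ℕ.+-cancelˡ-≤ N _ _ (ℕ.≤-pred (begin
      suc (N + m′)        ≤⟨ ℕ.+-monoˡ-≤ (N + m′) (ℕ.n≢0⇒n>0 i≢0) ⟩
      i + (N + m′)        ≡⟨ i+m≡n ⟩
      n                   ≡⟨ N+b+W≡ ⟨
      suc (N + b) + W     ≡⟨ cong suc (ℕ.+-assoc N b W) ⟩
      suc (N + (b + W))   ∎))
      where open ℕ.≤-Reasoning
  ...   | l , l∈ , l<m′ , m′≤l+W = deg-R-> i (N + m′) (N + l) i+m≡n (T-odd l∈) (ℕ.+-monoʳ-< N l<m′)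
            (subst (N + m′ ≤_) (sym (ℕ.+-assoc N l W)) (ℕ.+-monoʳ-≤ N m′≤l+W))

  i₀+t≡N+b : i₀ + t ≡ N + b
  i₀+t≡N+b = begin
    i₀ + t         ≡⟨ cong (i₀ +_) b+p≡t ⟨
    i₀ + (b + p)   ≡⟨ regroup i₀ b p ⟩
    i₀ + p + b     ≡⟨ cong (_+ b) i₀+p≡N ⟩
    N + b          ∎
    where
    open ≡-Reasoning
    regroup : ∀ i b p → i + (b + p) ≡ i + p + b
    regroup = ℕSolver.solve-∀

  -- As n = i₀ + (N + p), the exponents below N + p are those that do not wrap. The largest of them
  -- is `t`: past it f₁ has none, and the exponents of x^N f₂ start no earlier than N + p by
  -- `c-low`.
  deg-R-i₀ : deg (R n i₀) ≡ i₀ + t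
  deg-R-i₀ = deg-≡ (R n i₀) (trans (R-coeff i₀ t i₀+t<n) (T-even (top-element even-t))) above
    where
    i₀+t<n : i₀ + t < n
    i₀+t<n = subst (_< n) (sym i₀+t≡N+b) (subst (N + b <_) N+b+W≡ (ℕ.m≤m+n (suc (N + b)) W))

    T-gap : ∀ e → t < e → e < N + p → coeff T e ≡ 0ℤ
    T-gap e t<e e<N+p with ℕ.≤-<-connex N e
    ... | inj₂ e<N = trans (coeff-T-< e<N) (cong (indicator 1ℤ) (c-vanish t+p+q≡ e t<e))
    ... | inj₁ N≤e with ℕ.m≤n⇒∃[o]m+o≡n N≤e
    ...   | l , refl = trans (coeff-T-+ l) (indicator-≥0 (c-low l (ℕ.+-cancelˡ-< N l p e<N+p)))

    above : ∀ k → i₀ + t < k → coeff (R n i₀) k ≡ 0ℤ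
    above k lt with ℕ.≤-<-connex n k
    ... | inj₁ n≤k = coeff-%ₚ-≥ n T T-small i₀ k n≤k
    ... | inj₂ k<n with ℕ.m≤n⇒∃[o]m+o≡n (ℕ.≤-trans (ℕ.m≤m+n i₀ t) (ℕ.<⇒≤ lt))
    ...   | e , refl = trans (R-coeff i₀ e k<n) (T-gap e (ℕ.+-cancelˡ-< i₀ t e lt)
      (ℕ.+-cancelˡ-< i₀ e (N + p) (subst (i₀ + e <_) n≡i₀+ k<n)))
      where
      n≡i₀+ : n ≡ i₀ + (N + p)
      n≡i₀+ = trans n≡N+N (trans (cong (_+ N) (sym i₀+p≡N)) (regroup i₀ p N))
        where
        regroup : ∀ i p n → i + p + n ≡ i + (n + p)
        regroup = ℕSolver.solve-∀

  φ≡t : φ n ≡ t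
  φ≡t = ℕ.+-cancelʳ-≡ p _ _ (ℕ.+-cancelʳ-≡ q _ _ (trans (φ-2pq p-prime q-prime 2∤p 2∤q p<q) (sym t+p+q≡)))

  n/2+φ∸p≡ : n / 2 + φ n ∸ p ≡ i₀ + t
  n/2+φ∸p≡ = begin
    n / 2 + φ n ∸ p    ≡⟨ cong₂ (λ h f → h + f ∸ p) n/2≡N φ≡t ⟩
    N + t ∸ p          ≡⟨ cong (λ h → h + t ∸ p) i₀+p≡N ⟨
    i₀ + p + t ∸ p     ≡⟨ cong (_∸ p) (regroup i₀ p t) ⟩
    i₀ + t + p ∸ p     ≡⟨ ℕ.m+n∸n≡m (i₀ + t) p ⟩
    i₀ + t             ∎
    where
    open ≡-Reasoning
    regroup : ∀ i p t → i + p + t ≡ i + t + p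
    regroup = ℕSolver.solve-∀

  n∸2p∸q+1≡ : n ∸ 2 * p ∸ q + 1 ≡ i₀ + t
  n∸2p∸q+1≡ = begin
    n ∸ 2 * p ∸ q + 1             ≡⟨ cong (_+ 1) (ℕ.∸-+-assoc n (2 * p) q) ⟩
    n ∸ (2 * p + q) + 1           ≡⟨ cong (λ m → m ∸ (2 * p + q) + 1) n≡u+ ⟩
    u + (2 * p + q) ∸ (2 * p + q) + 1 ≡⟨ cong (_+ 1) (ℕ.m+n∸n≡m u (2 * p + q)) ⟩
    u + 1                         ≡⟨ ℕ.+-comm u 1 ⟩
    suc u                         ≡⟨ suc-u≡ ⟩
    i₀ + t                        ∎
    where
    open ≡-Reasoning
    -- `u` is n - 2 p - q; exhibiting n = u + (2 p + q) shows that the subtraction is not truncated.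
    u = i₀ + ℕ.pred t
    suc-u≡ : suc u ≡ i₀ + t
    suc-u≡ = trans (sym (ℕ.+-suc i₀ (ℕ.pred t))) (cong (i₀ +_) (ℕ.suc-pred t {{ℕ.>-nonZero 0<t}}))
      where
      0<t : 0 < t
      0<t = ℕ.<-≤-trans 0<p (subst (p ≤_) b+p≡t (ℕ.m≤n+m p b))
    n≡u+ : n ≡ u + (2 * p + q)
    n≡u+ = ℕ.suc-injective (sym (begin
      suc u + (2 * p + q)      ≡⟨ cong (_+ (2 * p + q)) suc-u≡ ⟩
      i₀ + t + (2 * p + q)     ≡⟨ regroup i₀ t p q ⟩
      i₀ + p + (t + p + q)     ≡⟨ cong₂ _+_ i₀+p≡N t+p+q≡ ⟩
      N + suc N                ≡⟨ ℕ.+-suc N N ⟩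
      suc (N + N)              ≡⟨ cong suc n≡N+N ⟨
      suc n                    ∎))
      where
      regroup : ∀ i t p q → i + t + (2 * p + q) ≡ i + p + (t + p + q)
      regroup = ℕSolver.solve-∀

  theorem : (∀ i → i < n → i ≢ 0 → i ≢ n / 2 ∸ p → deg (R n i) > deg (ΦT n))
    × deg (ΦT n) ≡ deg (R n (n / 2 ∸ p))
    × deg (R n (n / 2 ∸ p)) ≡ n / 2 + φ n ∸ p
    × n / 2 + φ n ∸ p ≡ n ∸ 2 * p ∸ q + 1
  theorem = part₁
    , trans deg-T (trans (sym i₀+t≡N+b) (sym deg-R))
    , trans deg-R (sym n/2+φ∸p≡)
    , trans n/2+φ∸p≡ (sym n∸2p∸q+1≡)
    where
    deg-R : deg (R n (n / 2 ∸ p)) ≡ i₀ + t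
    deg-R = trans (cong (λ h → deg (R n (h ∸ p))) n/2≡N) deg-R-i₀

theorem2p3 : ∀ (p q : ℕ) → Prime p → Prime q → 2 ∤ p → 2 ∤ q → p < q →
    let n = 2 * p * q in
    (∀ i → i < n → i ≢ 0 → i ≢ n / 2 ∸ p → deg (R n i) > deg (ΦT n))
    × deg (ΦT n) ≡ deg (R n (n / 2 ∸ p))
    × deg (R n (n / 2 ∸ p)) ≡ n / 2 + φ n ∸ p
    × n / 2 + φ n ∸ p ≡ n ∸ 2 * p ∸ q + 1
theorem2p3 p q p-prime q-prime 2∤p 2∤q p<q = from-inverses I refl refl
  where
  1<p = prime⇒>1 p-prime

  I : Inverses p q
  I = coprime⇒Inverses 1<p (ℕ.<-trans 1<p p<q) (prime∤⇒coprime q-prime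
    (∣.>⇒∤ {{prime⇒nonZero p-prime}} p<q))

  -- α = 0 or β = 0 would equate 0 with a successor, and α = 1 would give p = 1 + β′ q, hence p = 1
  -- or p > q. With α ≥ 2 the lattice contains `p`, its first odd element.
  from-inverses : ∀ (I : Inverses p q) {a b} → Inverses.α I ≡ a → Inverses.β I ≡ b → _
  from-inverses I {suc (suc r)} {suc s} α≡ β≡ = Main.theorem p-prime q-prime 2∤p 2∤q p<q I α≡ z<s β≡
  from-inverses (inverses _ _ _ _ _ _ () _) {zero} refl _
  from-inverses (inverses _ _ _ _ _ _ _ ()) {_} {zero} _ refl
  from-inverses (inverses _ _ _ zero _ _ p≡1 _) {suc zero} {suc s} refl _ =
    contradiction (trans (sym (ℕ.+-identityʳ p)) p≡1) (ℕ.>⇒≢ 1<p)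
  from-inverses (inverses _ _ _ (suc β′) _ _ p≡1+β′q _) {suc zero} {suc s} refl _ =
    contradiction (ℕ.≤-trans (ℕ.m≤m+n q (β′ * q)) (ℕ.n≤1+n _))
      (ℕ.<⇒≱ (subst (_< q) (trans (sym (ℕ.+-identityʳ p)) p≡1+β′q) p<q))
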